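{- Let $n\geqslant 6$, let $i$ be an integer with $1<i<n-2$, $i\neq 2$, and let $G$ be a connected graph of order $n$. Then $G$ realizes $S_{\{i,n-2\}_n^{2}}$ if and only if $G=K_1\vee \left(K_{1}\cup H\right)$, where $H$ is a graph on $n-2$ vertices realizing $S_{\{i-1,n-3\}_{n-2}^{1}}$.
   Context: For a simple graph $G$, its Laplacian spectrum is the multiset of eigenvalues of $L(G)=D-A$. For integers $0<i<j\leqslant n$ and $m\in\{1,\dots,n\}\setminus\{i,j\}$, $S_{\{i,j\}_{n}^{m}}$ denotes the multiset $\{0,1,\ldots,m-1,m,m,m+1,\ldots,n\}\setminus\{i,j\}$. A graph realizes a multiset $S$ if it is simple, connected, and its Laplacian spectrum (with multiplicities) equals $S$. $K_1$ is a single vertex, $\cup$ disjoint union, $X\vee Y$ the join (disjoint union plus all edges between $X$ and $Y$). -}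

module Defs where

open import Data.Nat as ℕ using (ℕ; zero; suc)
open import Data.Fin using (Fin; zero; suc; splitAt; punchIn; _≟_)
open import Data.Bool using (Bool; true; false; if_then_else_)
open import Data.Sum using (_⊎_; inj₁; inj₂)
open import Data.Product using (Σ; _×_; _,_)
open import Data.List using (List; []; _∷_; _++_; map; upTo)
open import Data.Integer as ℤ using (ℤ; +_)
open import Relation.Nullary using (yes; no; does)
open import Relation.Binary.PropositionalEquality using (_≡_; refl)
open import Function.Bundles using (_↔_; Inverse)

record Graph (n : ℕ) : Set where
  field
    adj    : Fin n → Fin n → Bool
    sym    : ∀ u v → adj u v ≡ adj v u
    irrefl : ∀ u → adj u u ≡ false
open Graph public

data Reach {n : ℕ} (G : Graph n) : Fin n → Fin n → Set where
  here : ∀ {u} → Reach G u u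
  step : ∀ {u v w} → adj G u v ≡ true → Reach G v w → Reach G u w

Connected : ∀ {n} → Graph n → Set
Connected {n} G = ∀ (u v : Fin n) → Reach G u v

_≅_ : ∀ {n m} → Graph n → Graph m → Set
_≅_ {n} {m} G H = Σ (Fin n ↔ Fin m) λ f →
  ∀ u v → adj G u v ≡ adj H (Inverse.to f u) (Inverse.to f v)

private
  combAdj : ∀ {a b} → Bool → Graph a → Graph b → Fin (a ℕ.+ b) → Fin (a ℕ.+ b) → Bool
  combAdj {a} c G H u v with splitAt a u | splitAt a v
  ... | inj₁ x | inj₁ y = adj G x y
  ... | inj₂ x | inj₂ y = adj H x y
  ... | inj₁ _ | inj₂ _ = c
  ... | inj₂ _ | inj₁ _ = c

  combSym : ∀ {a b} c (G : Graph a) (H : Graph b) u v → combAdj c G H u v ≡ combAdj c G H v u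
  combSym {a} c G H u v with splitAt a u | splitAt a v
  ... | inj₁ x | inj₁ y = sym G x y
  ... | inj₂ x | inj₂ y = sym H x y
  ... | inj₁ _ | inj₂ _ = refl
  ... | inj₂ _ | inj₁ _ = refl

  combIrr : ∀ {a b} c (G : Graph a) (H : Graph b) u → combAdj c G H u u ≡ false
  combIrr {a} c G H u with splitAt a u
  ... | inj₁ x = irrefl G x
  ... | inj₂ x = irrefl H x

  combine : ∀ {a b} → Bool → Graph a → Graph b → Graph (a ℕ.+ b)
  combine c G H = record { adj = combAdj c G H ; sym = combSym c G H ; irrefl = combIrr c G H }

_∪ᴳ_ : ∀ {a b} → Graph a → Graph b → Graph (a ℕ.+ b)
G ∪ᴳ H = combine false G H

_∨ᴳ_ : ∀ {a b} → Graph a → Graph b → Graph (a ℕ.+ b)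
G ∨ᴳ H = combine true G H

K₁ : Graph 1
K₁ = record { adj = λ _ _ → false ; sym = λ _ _ → refl ; irrefl = λ _ → refl }

Matrix : ℕ → Set
Matrix n = Fin n → Fin n → ℤ

det : ∀ {n} → Matrix n → ℤ
det {zero}  M = ℤ.+ 1
det {suc n} M = cols (suc n) (λ x → x) (ℤ.+ 1)
  where
  minor : Fin (suc n) → Matrix n
  minor j r c = M (suc r) (punchIn j c)
  cols : ∀ k → (Fin k → Fin (suc n)) → ℤ → ℤ
  cols zero    _ _ = ℤ.+ 0
  cols (suc k) f s = s ℤ.* M zero (f zero) ℤ.* det (minor (f zero)) ℤ.+ cols k (λ x → f (suc x)) (ℤ.- s)

count : ∀ {n} → (Fin n → Bool) → ℕ
count {zero}  p = 0
count {suc n} p = (if p zero then 1 else 0) ℕ.+ count (λ x → p (suc x))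

degree : ∀ {n} → Graph n → Fin n → ℕ
degree G u = count (adj G u)

laplacian : ∀ {n} → Graph n → Matrix n
laplacian G u v =
  if does (u ≟ v) then + degree G u
  else (if adj G u v then ℤ.- (+ 1) else + 0)

charPolyAt : ∀ {n} → Graph n → ℤ → ℤ
charPolyAt G x = det (λ u v → (if does (u ≟ v) then x else + 0) ℤ.- laplacian G u v)

prodℤ : List ℤ → ℤ
prodℤ [] = + 1
prodℤ (x ∷ xs) = x ℤ.* prodℤ xs

-- The Laplacian spectrum of G (with multiplicities) is the multiset S,
-- i.e. det(xI - L(G)) = ∏_{s ∈ S} (x - s) as polynomials; since both sides
-- are integer polynomials, this is equality at every integer x.
LaplacianSpectrumIs : ∀ {n} → Graph n → List ℕ → Set
LaplacianSpectrumIs G S = ∀ (x : ℤ) → charPolyAt G x ≡ prodℤ (map (λ s → x ℤ.- + s) S)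

Realizes : ∀ {n} → Graph n → List ℕ → Set
Realizes G S = Connected G × LaplacianSpectrumIs G S

removeOne : ℕ → List ℕ → List ℕ
removeOne k [] = []
removeOne k (x ∷ xs) = if does (k ℕ.≟ x) then xs else x ∷ removeOne k xs

S[_,_]_^_ : ℕ → ℕ → ℕ → ℕ → List ℕ
S[ i , j ] n ^ m = removeOne j (removeOne i (upTo (suc n) ++ (m ∷ [])))

{-# OPTIONS --safe #-}
-- If n is a Laplacian eigenvalue of G, an eigenvector a for it is harmonic on the complement
-- of G, so the set where a is maximal is a union of components of the complement. An
-- eigenvector w for 1 has eigenvalue n − 1 on the complement, which a component of fewer than
-- n − 1 vertices cannot carry; so the complement has an isolated vertex u and G = K₁ ∨ (G − u).
-- On G − u the vector w is harmonic and an eigenvector of G for n − 1 has eigenvalue n − 2, so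
-- the same argument isolates a vertex of G − u. The characteristic polynomials are related by
-- (x − 1) p(K₁ ∨ G′)(x) = x (x − n) p(G′)(x − 1) and p(K₁ ∪ H)(x) = x p(H)(x), and 0 being a
-- simple root of p(H) makes H connected. Cancellation of factors only uses that p(x) ≡ p(y)
-- modulo x − y, which forces two such functions to agree once they agree at all large integers.
module Submission where

open import Defs renaming (sym to adj-sym)
import Algebra.Properties.Semiring.Sum as SemiringSum
open import Data.Bool using (Bool; true; false; not; if_then_else_; _xor_)
import Data.Bool.Properties as Bool
open import Data.Fin using (Fin; zero; suc; punchIn; punchOut; _≟_)
open import Data.Fin.Permutation using (insert; insert-punchIn; _⟨$⟩ʳ_)
open import Data.Fin.Properties using (suc-injective; punchInᵢ≢i; punchIn-punchOut; any?; all?; ¬∀⟶∃¬)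
open import Data.Fin.Subset using (Subset; _∈_; _⊃_; _∪_; ⁅_⁆)
open import Data.Fin.Subset.Induction using (⊃-wellFounded; Acc; acc)
open import Data.Fin.Subset.Properties using (_∈?_; x∈⁅x⁆; x∈⁅y⁆⇒x≡y; p⊆p∪q; q⊆p∪q; x∈p∪q⁻)
open import Data.Integer using (ℤ; +_; 0ℤ; 1ℤ; -1ℤ; _+_; _*_; -_; _-_)
import Data.Integer as ℤ
open import Data.Integer.Divisibility.Signed using (_∣_; divides; ∣⇒∣ᵤ; ∣m∣n⇒∣m+n; ∣n⇒∣m*n; ∣m⇒∣m*n)
import Data.Integer.Properties as ℤ
open import Data.Integer.Tactic.RingSolver using (solve-∀)
open import Data.List using (List; []; _∷_; _++_; _∷ʳ_; map; upTo; applyUpTo)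
import Data.List.Membership.Propositional as List
import Data.List.Membership.Propositional.Properties as List
import Data.List.Properties as List
open import Data.List.Relation.Binary.Permutation.Propositional using (_↭_; prep; ↭-trans; ↭-reflexive)
import Data.List.Relation.Binary.Permutation.Propositional as Perm
import Data.List.Relation.Binary.Permutation.Propositional.Properties as Perm
open import Data.List.Relation.Unary.All using (All; []; _∷_)
import Data.List.Relation.Unary.All.Properties as All
open import Data.List.Relation.Unary.Any using (here; there)
open import Data.Nat using (ℕ; zero; suc; _≤_; _<_; _∸_)
import Data.Nat as ℕ
import Data.Nat.Divisibility as ℕ
import Data.Nat.Properties as ℕ
open import Data.Product using (Σ; Σ-syntax; ∃-syntax; _×_; _,_; proj₁; proj₂)
open import Data.Sum using (_⊎_; inj₁; inj₂)
open import Data.Vec.Functional using (Vector; updateAt; tail) renaming (_∷_ to _∷ᵛ_)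
open import Data.Vec.Functional.Properties using (updateAt-updates; updateAt-minimal)
open import Function using (_∘_; const; id)
open import Function.Bundles using (_⇔_; mk⇔; _↔_; Inverse)
import Function.Construct.Identity as Identity
open import Relation.Binary.PropositionalEquality using (_≡_; _≢_; _≗_; refl; sym; trans; cong; cong₂; subst; subst₂; module ≡-Reasoning)
open import Relation.Nullary using (¬_; Dec; yes; no; does; contradiction)
open import Relation.Nullary.Decidable using (_×-dec_; decidable-stable; ¬?; dec-true; dec-false)

-- Everything stays over the integers: no diagonalisation, no real eigenvectors, no formal
-- polynomials. A root of the characteristic polynomial becomes an integer eigenvector through
-- cofactors, as in Cramer's rule, and for this the determinant, given only by expansion along its
-- first row, must first be shown to be alternating. Orthogonality of eigenvectors is replaced by
-- one fact: a function constant along edges is a left null vector of the Laplacian. It makes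
-- eigenvectors for nonzero eigenvalues sum to zero, both in total and on each side of a separation,
-- and it produces the factor x^2 for a disconnected graph. A bound on the largest eigenvalue of a
-- small component is replaced by an estimate at a vertex where the vector is maximal. The
-- eigenvalues used are n, 1 and n - 1. The last two survive because the removed numbers i and n - 2
-- lie strictly between 1 and n - 1. Without 0 and n, the outer multiset is the inner one shifted by
-- one, so the doubled 2 comes from the doubled 1.

private module Sum = SemiringSum ℤ.+-*-semiring

-- Finite sums

-- Opaque because unification would otherwise unfold the additions of a sum.
opaque
  ∑ : ∀ {n} → Vector ℤ n → ℤ
  ∑ = Sum.sum

  ∑-empty : (f : Vector ℤ 0) → ∑ f ≡ 0ℤ
  ∑-empty f = refl

  ∑-suc : ∀ {n} (f : Vector ℤ (suc n)) → ∑ f ≡ f zero + ∑ (λ i → f (suc i))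
  ∑-suc f = refl

  ∑-cong : ∀ {n} {f g : Vector ℤ n} → f ≗ g → ∑ f ≡ ∑ g
  ∑-cong = Sum.sum-cong-≗

  ∑-+ : ∀ {n} (f g : Vector ℤ n) → ∑ (λ i → f i + g i) ≡ ∑ f + ∑ g
  ∑-+ = Sum.∑-distrib-+

  ∑-*ˡ : ∀ {n} c (f : Vector ℤ n) → ∑ (λ i → c * f i) ≡ c * ∑ f
  ∑-*ˡ c f = sym (Sum.*-distribˡ-sum c f)

  ∑-swap : ∀ {m n} (f : Fin m → Fin n → ℤ) → ∑ (λ i → ∑ (f i)) ≡ ∑ (λ j → ∑ (λ i → f i j))
  ∑-swap f = Sum.∑-comm f

  ∑-permute : ∀ {m n} (f : Vector ℤ n) (π : Fin m ↔ Fin n) → ∑ f ≡ ∑ (f ∘ Inverse.to π)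
  ∑-permute f π = Sum.sum-permute f π

  ∑-remove : ∀ {n} (i : Fin (suc n)) (f : Vector ℤ (suc n)) → ∑ f ≡ f i + ∑ (f ∘ punchIn i)
  ∑-remove i f = Sum.sum-remove {i = i} f

∑-zero : ∀ {n} {f : Vector ℤ n} → (∀ i → f i ≡ 0ℤ) → ∑ f ≡ 0ℤ
∑-zero {zero}  {f} f≡0 = ∑-empty f
∑-zero {suc n} {f} f≡0 = trans (∑-suc f) (cong₂ _+_ (f≡0 zero) (∑-zero (f≡0 ∘ suc)))

∑-linear : ∀ {n} (a b : ℤ) (f g : Vector ℤ n) → ∑ (λ i → a * f i + b * g i) ≡ a * ∑ f + b * ∑ g
∑-linear a b f g = trans (∑-+ (λ i → a * f i) (λ i → b * g i)) (cong₂ _+_ (∑-*ˡ a f) (∑-*ˡ b g))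

-- Determinants

minor : ∀ {n} → Matrix (suc n) → Fin (suc n) → Matrix n
minor M j r c = M (suc r) (punchIn j c)

-- `cols` is the local function of `Defs.det`, which has no name here. Generalising
-- `suc m`, the column map and the sign in one unfolding of `det` leaves a constraint
-- that determines it by pattern unification.
mutual
  cols : ∀ {n} (M : Matrix (suc n)) k → (Fin k → Fin (suc n)) → ℤ → ℤ
  cols {n} M k f s = _

  det-unfold₂ : ∀ {m} (M : Matrix (suc (suc m))) →
    det M ≡ + 1 * M zero zero * det (minor M zero) +
      (- (+ 1) * M zero (suc zero) * det (minor M (suc zero)) + cols M m (λ x → suc (suc x)) (+ 1))
  det-unfold₂ {m} M with det (minor M zero) | det (minor M (suc zero)) | M zero (suc zero)
  ... | _ | _ | _ with suc m | (λ (x : Fin m) → Fin.suc (Fin.suc x)) | + 1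
  ... | _ | _ | _ = refl

alt : ∀ {n} → Fin n → ℤ
alt zero    = 1ℤ
alt (suc i) = - alt i

cols-sum : ∀ {n} (M : Matrix (suc n)) k f s →
  cols M k f s ≡ ∑ (λ x → s * alt x * M zero (f x) * det (minor M (f x)))
cols-sum M zero    f s = sym (∑-empty _)
cols-sum M (suc k) f s = sym (begin
  ∑ (λ x → s * alt x * M zero (f x) * det (minor M (f x)))
    ≡⟨ ∑-suc _ ⟩
  s * 1ℤ * M zero (f zero) * det (minor M (f zero)) + ∑ (λ x → s * - alt x * M zero (f (suc x)) * det (minor M (f (suc x))))
    ≡⟨ cong₂ _+_ (head-term s (M zero (f zero)) (det (minor M (f zero))))
                 (∑-cong λ x → tail-term s (alt x) (M zero (f (suc x))) (det (minor M (f (suc x))))) ⟩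
  s * M zero (f zero) * det (minor M (f zero)) + ∑ (λ x → - s * alt x * M zero (f (suc x)) * det (minor M (f (suc x))))
    ≡⟨ cong (_+_ (s * M zero (f zero) * det (minor M (f zero)))) (cols-sum M k (f ∘ suc) (- s)) ⟨
  s * M zero (f zero) * det (minor M (f zero)) + cols M k (f ∘ suc) (- s) ∎)
  where
  open ≡-Reasoning
  head-term : ∀ s x d → s * 1ℤ * x * d ≡ s * x * d
  head-term = solve-∀
  tail-term : ∀ s a x d → s * - a * x * d ≡ - s * a * x * d
  tail-term = solve-∀

cofactor : ∀ {n} → Matrix (suc n) → Fin (suc n) → ℤ
cofactor M j = alt j * det (minor M j)

det-expand : ∀ {n} (M : Matrix (suc n)) → det M ≡ ∑ (λ j → M zero j * cofactor M j)
det-expand M = trans (cols-sum M _ id 1ℤ) (∑-cong λ j → rearranged (alt j) (M zero j) (det (minor M j)))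
  where
  rearranged : ∀ a x d → 1ℤ * a * x * d ≡ x * (a * d)
  rearranged = solve-∀

-- Alternating multilinear functions of the rows

_≈ₘ_ : ∀ {k n} → (A B : Fin k → Vector ℤ n) → Set
A ≈ₘ B = ∀ i j → A i j ≡ B i j

_≈[_]_ : ∀ {k n} → (Fin k → Vector ℤ n) → Fin k → (Fin k → Vector ℤ n) → Set
A ≈[ r ] B = ∀ i → i ≢ r → A i ≗ B i

-- Rows and columns are counted separately because fixing the first row of a square matrix leaves
-- fewer rows than columns. `ext` is a field because matrices are functions, compared only
-- pointwise.
record Multilinear {k n} (f : (Fin k → Vector ℤ n) → ℤ) : Set where
  field
    ext    : ∀ {A B} → A ≈ₘ B → f A ≡ f B
    linear : ∀ r a b {A B C} → A ≈[ r ] C → B ≈[ r ] C →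
             (∀ j → C r j ≡ a * A r j + b * B r j) → f C ≡ a * f A + b * f B

record Alternating {k n} (f : (Fin k → Vector ℤ n) → ℤ) : Set where
  field
    multilinear : Multilinear f
    repeat      : ∀ {r s A} → r ≢ s → A r ≗ A s → f A ≡ 0ℤ
  open Multilinear multilinear public

open Multilinear
open Alternating using (multilinear; repeat)

det-ext : ∀ {n} {A B : Matrix n} → A ≈ₘ B → det A ≡ det B
det-ext {zero}          A≈B = refl
det-ext {suc n} {A} {B} A≈B = begin
  det A                             ≡⟨ det-expand A ⟩
  ∑ (λ j → A zero j * cofactor A j) ≡⟨ ∑-cong (λ j → cong₂ (λ x d → x * (alt j * d))
                                         (A≈B zero j) (det-ext (λ r c → A≈B (suc r) (punchIn j c)))) ⟩
  ∑ (λ j → B zero j * cofactor B j) ≡⟨ det-expand B ⟨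
  det B                             ∎
  where open ≡-Reasoning

det-linear : ∀ {n} (r : Fin n) a b {A B C} → A ≈[ r ] C → B ≈[ r ] C →
  (∀ j → C r j ≡ a * A r j + b * B r j) → det C ≡ a * det A + b * det B
det-linear {suc n} r a b {A} {B} {C} A≈C B≈C row = begin
  det C                             ≡⟨ det-expand C ⟩
  ∑ (λ j → C zero j * cofactor C j) ≡⟨ ∑-cong (terms r A≈C B≈C row) ⟩
  ∑ (λ j → a * (A zero j * cofactor A j) + b * (B zero j * cofactor B j))
                                    ≡⟨ ∑-linear a b _ _ ⟩
  a * ∑ (λ j → A zero j * cofactor A j) + b * ∑ (λ j → B zero j * cofactor B j)
                                    ≡⟨ cong₂ (λ x y → a * x + b * y) (det-expand A) (det-expand B) ⟨
  a * det A + b * det B             ∎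
  where
  open ≡-Reasoning
  entry-linear : ∀ s a b x y d → (a * x + b * y) * (s * d) ≡ a * (x * (s * d)) + b * (y * (s * d))
  entry-linear = solve-∀
  minor-linear : ∀ s a b x d e → x * (s * (a * d + b * e)) ≡ a * (x * (s * d)) + b * (x * (s * e))
  minor-linear = solve-∀
  terms : ∀ r → A ≈[ r ] C → B ≈[ r ] C → (∀ j → C r j ≡ a * A r j + b * B r j) → ∀ j →
    C zero j * cofactor C j ≡ a * (A zero j * cofactor A j) + b * (B zero j * cofactor B j)
  terms zero A≈C B≈C row j
    rewrite det-ext {A = minor A j} {minor C j} (λ r c → A≈C (suc r) (λ ()) (punchIn j c))
          | det-ext {A = minor B j} {minor C j} (λ r c → B≈C (suc r) (λ ()) (punchIn j c))
          | row j = entry-linear (alt j) a b (A zero j) (B zero j) (det (minor C j))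
  terms (suc r) A≈C B≈C row j
    rewrite A≈C zero (λ ()) j | B≈C zero (λ ()) j
          | det-linear r a b {minor A j} {minor B j} {minor C j}
              (λ i i≢r c → A≈C (suc i) (i≢r ∘ suc-injective) (punchIn j c))
              (λ i i≢r c → B≈C (suc i) (i≢r ∘ suc-injective) (punchIn j c))
              (λ c → row (punchIn j c))
          = minor-linear (alt j) a b (C zero j) (det (minor A j)) (det (minor B j))

det-multilinear : ∀ {n} → Multilinear (det {n})
det-multilinear = record { ext = det-ext ; linear = det-linear }

_[_]≔_ : ∀ {k n} → (Fin k → Vector ℤ n) → Fin k → Vector ℤ n → (Fin k → Vector ℤ n)
A [ r ]≔ v = updateAt A r (const v)

≔-at : ∀ {k n} (A : Fin k → Vector ℤ n) r v → (A [ r ]≔ v) r ≡ v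
≔-at A r v = updateAt-updates r A

≔-off : ∀ {k n} (A : Fin k → Vector ℤ n) r v {i} → i ≢ r → (A [ r ]≔ v) i ≡ A i
≔-off A r v i≢r = updateAt-minimal _ r A i≢r

≡⇒≗ : ∀ {n} {u v : Vector ℤ n} → u ≡ v → u ≗ v
≡⇒≗ refl _ = refl

cons-multilinear : ∀ {k n} {f : (Fin (suc k) → Vector ℤ n) → ℤ} x →
  Multilinear f → Multilinear (λ B → f (x ∷ᵛ B))
cons-multilinear {f = f} x ml = record
  { ext    = λ A≈B → ext ml λ { zero j → refl ; (suc i) j → A≈B i j }
  ; linear = λ r a b A≈C B≈C row → linear ml (suc r) a b
      (λ { zero _ j → refl ; (suc i) i≢r j → A≈C i (i≢r ∘ cong suc) j })
      (λ { zero _ j → refl ; (suc i) i≢r j → B≈C i (i≢r ∘ cong suc) j })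
      row
  }

cons-alternating : ∀ {k n} {f : (Fin (suc k) → Vector ℤ n) → ℤ} x →
  Alternating f → Alternating (λ B → f (x ∷ᵛ B))
cons-alternating x af = record
  { multilinear = cons-multilinear x (multilinear af)
  ; repeat      = λ r≢s → repeat af (r≢s ∘ suc-injective)
  }

-- Polarisation: with `x+y` in both rows the value is 0, and expanding it leaves only the two mixed
-- terms.
swap : ∀ {k n} {f : (Fin k → Vector ℤ n) → ℤ} → Alternating f → ∀ {r s} → r ≢ s → ∀ {A B} →
  A r ≗ B s → A s ≗ B r → (∀ i → i ≢ r → i ≢ s → A i ≗ B i) → f A ≡ - f B
swap {f = f} af {r} {s} r≢s {A} {B} Ar≗Bs As≗Br A≗B = begin
  f A                 ≡⟨ ext ml A≈Nxy ⟩
  f (N x y)           ≡⟨ negate (f (N x y)) (f (N y x)) total ⟩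
  - f (N y x)         ≡⟨ cong -_ (ext ml Nyx≈B) ⟩
  - f B               ∎
  where
  open ≡-Reasoning
  ml = multilinear af
  x = A r
  y = A s
  x+y : Vector ℤ _
  x+y j = x j + y j
  N : Vector ℤ _ → Vector ℤ _ → Fin _ → Vector ℤ _
  N u v = (A [ r ]≔ u) [ s ]≔ v
  N-s : ∀ u v → N u v s ≡ v
  N-s u v = ≔-at _ s v
  N-r : ∀ u v → N u v r ≡ u
  N-r u v = trans (≔-off _ s v r≢s) (≔-at A r u)
  N-off : ∀ u v {i} → i ≢ r → i ≢ s → N u v i ≡ A i
  N-off u v i≢r i≢s = trans (≔-off _ s v i≢s) (≔-off A r u i≢r)
  unit : ∀ a b → 1ℤ * a + 1ℤ * b ≡ a + b
  unit = solve-∀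
  add-r : ∀ u u′ w v → (∀ j → w j ≡ u j + u′ j) → f (N w v) ≡ f (N u v) + f (N u′ v)
  add-r u u′ w v w≗ = trans (linear ml r 1ℤ 1ℤ (off u) (off u′) row) (unit (f (N u v)) (f (N u′ v)))
    where
    off : ∀ u → N u v ≈[ r ] N w v
    off u i i≢r with i ≟ s
    ... | yes refl = ≡⇒≗ (trans (N-s u v) (sym (N-s w v)))
    ... | no i≢s   = ≡⇒≗ (trans (N-off u v i≢r i≢s) (sym (N-off w v i≢r i≢s)))
    row : ∀ j → N w v r j ≡ 1ℤ * N u v r j + 1ℤ * N u′ v r j
    row j rewrite N-r u v | N-r u′ v | N-r w v = trans (w≗ j) (sym (unit (u j) (u′ j)))
  add-s : ∀ v v′ w u → (∀ j → w j ≡ v j + v′ j) → f (N u w) ≡ f (N u v) + f (N u v′)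
  add-s v v′ w u w≗ = trans (linear ml s 1ℤ 1ℤ (off v) (off v′) row) (unit (f (N u v)) (f (N u v′)))
    where
    off : ∀ v → N u v ≈[ s ] N u w
    off v i i≢s = ≡⇒≗ (trans (≔-off _ s v i≢s) (sym (≔-off _ s w i≢s)))
    row : ∀ j → N u w s j ≡ 1ℤ * N u v s j + 1ℤ * N u v′ s j
    row j rewrite N-s u v | N-s u v′ | N-s u w = trans (w≗ j) (sym (unit (v j) (v′ j)))
  same : ∀ u → f (N u u) ≡ 0ℤ
  same u = repeat af r≢s (≡⇒≗ (trans (N-r u u) (sym (N-s u u))))
  total : f (N x y) + f (N y x) ≡ 0ℤ
  total = begin
    f (N x y) + f (N y x)
      ≡⟨ cong₂ _+_ (ℤ.+-identityˡ (f (N x y))) (ℤ.+-identityʳ (f (N y x))) ⟨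
    0ℤ + f (N x y) + (f (N y x) + 0ℤ)
      ≡⟨ cong₂ (λ a b → a + f (N x y) + (f (N y x) + b)) (same x) (same y) ⟨
    f (N x x) + f (N x y) + (f (N y x) + f (N y y))
      ≡⟨ cong₂ _+_ (add-s x y x+y x (λ _ → refl)) (add-s x y x+y y (λ _ → refl)) ⟨
    f (N x x+y) + f (N y x+y)
      ≡⟨ add-r x y x+y x+y (λ _ → refl) ⟨
    f (N x+y x+y)
      ≡⟨ same x+y ⟩
    0ℤ ∎
  negate : ∀ a b → a + b ≡ 0ℤ → a ≡ - b
  negate a b a+b≡0 = trans (cancel a b) (trans (cong (_- b) a+b≡0) (ℤ.+-identityˡ (- b)))
    where
    cancel : ∀ a b → a ≡ a + b - b
    cancel = solve-∀
  A≈Nxy : A ≈ₘ N x y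
  A≈Nxy i with i ≟ r | i ≟ s
  ... | yes refl | _        = ≡⇒≗ (sym (N-r x y))
  ... | no _     | yes refl = ≡⇒≗ (sym (N-s x y))
  ... | no i≢r   | no i≢s   = ≡⇒≗ (sym (N-off x y i≢r i≢s))
  Nyx≈B : N y x ≈ₘ B
  Nyx≈B i j with i ≟ r | i ≟ s
  ... | yes refl | _        = trans (≡⇒≗ (N-r y x) j) (As≗Br j)
  ... | no _     | yes refl = trans (≡⇒≗ (N-s y x) j) (Ar≗Bs j)
  ... | no i≢r   | no i≢s   = trans (≡⇒≗ (N-off y x i≢r i≢s) j) (A≗B i i≢r i≢s j)

-- In the Laplace expansion of two equal rows along both of them, the summand for the
-- ordered pair of columns (a, b) cancels against the one for (b, a).
double-expansion : ∀ {m} (x : Vector ℤ (suc (suc m))) (E : (Fin m → Fin (suc (suc m))) → ℤ) →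
  (∀ {g h} → g ≗ h → E g ≡ E h) →
  ∑ (λ j → ∑ (λ k → x j * (alt j * (x (punchIn j k) * (alt k * E (punchIn j ∘ punchIn k)))))) ≡ 0ℤ
double-expansion {m} x E E-ext = begin
  ∑ (λ j → ∑ (F j))
    ≡⟨ ∑-suc _ ⟩
  ∑ (F zero) + ∑ (λ j → ∑ (F (suc j)))
    ≡⟨ cong (_+_ (∑ (F zero))) (trans (∑-cong (λ j → ∑-suc (F (suc j)))) (∑-+ _ _)) ⟩
  ∑ (F zero) + (∑ (λ j → F (suc j) zero) + ∑ (λ j → ∑ (λ k → F (suc j) (suc k))))
    ≡⟨ ℤ.+-assoc (∑ (F zero)) _ _ ⟨
  ∑ (F zero) + ∑ (λ j → F (suc j) zero) + ∑ (λ j → ∑ (λ k → F (suc j) (suc k)))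
    ≡⟨ cong₂ _+_ (trans (sym (∑-+ _ _)) (∑-zero λ k →
         opposite-terms (x zero) (x (suc k)) (alt k) (E (λ c → suc (punchIn k c)))))
         (rest m x E E-ext) ⟩
  0ℤ ∎
  where
  open ≡-Reasoning
  F : Fin (suc (suc m)) → Fin (suc m) → ℤ
  F j k = x j * (alt j * (x (punchIn j k) * (alt k * E (punchIn j ∘ punchIn k))))
  opposite-terms : ∀ x y a e → x * (1ℤ * (y * (a * e))) + y * (- a * (x * (1ℤ * e))) ≡ 0ℤ
  opposite-terms = solve-∀
  drop-signs : ∀ x y a b e → x * (- a * (y * (- b * e))) ≡ x * (a * (y * (b * e)))
  drop-signs = solve-∀
  rest : ∀ m (x : Vector ℤ (suc (suc m))) (E : (Fin m → Fin (suc (suc m))) → ℤ) →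
    (∀ {g h} → g ≗ h → E g ≡ E h) →
    ∑ (λ j → ∑ (λ k → x (suc j) * (- alt j * (x (suc (punchIn j k)) *
      (- alt k * E (punchIn (suc j) ∘ punchIn (suc k))))))) ≡ 0ℤ
  rest zero    x E E-ext = ∑-zero λ j → ∑-empty _
  rest (suc m) x E E-ext = trans
    (∑-cong λ j → ∑-cong λ k → trans
      (drop-signs (x (suc j)) (x (suc (punchIn j k))) (alt j) (alt k) _)
      (cong (λ e → x (suc j) * (alt j * (x (suc (punchIn j k)) * (alt k * e))))
        (E-ext λ { zero → refl ; (suc c) → refl })))
    -- Column 0 is not among the two expanded columns, so these pairs form a double expansion over
    -- the other columns. `lift` puts column 0 back into each minor, and the two extra signs have
    -- cancelled.
    (double-expansion (x ∘ suc) (λ g → E (lift g))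
      λ g≗h → E-ext λ { zero → refl ; (suc c) → cong suc (g≗h c) })
    where
    lift : (Fin m → Fin (suc (suc m))) → Fin (suc m) → Fin (suc (suc (suc m)))
    lift g zero    = zero
    lift g (suc c) = suc (g c)

det-zero-minors : ∀ {n} (A : Matrix (suc n)) → (∀ j → det (minor A j) ≡ 0ℤ) → det A ≡ 0ℤ
det-zero-minors A minors≡0 = trans (det-expand A) (∑-zero λ j →
  trans (cong (λ d → A zero j * (alt j * d)) (minors≡0 j)) (annihilate (A zero j) (alt j)))
  where
  annihilate : ∀ x a → x * (a * 0ℤ) ≡ 0ℤ
  annihilate = solve-∀

det-repeat₀₁ : ∀ {n} {A : Matrix (suc (suc n))} → A zero ≗ A (suc zero) → det A ≡ 0ℤ
det-repeat₀₁ {n} {A} A₀≗A₁ = begin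
  det A
    ≡⟨ det-expand A ⟩
  ∑ (λ j → A zero j * cofactor A j)
    ≡⟨ (∑-cong λ j → trans (cong (λ d → A zero j * (alt j * d)) (det-expand (minor A j)))
         (trans (distribute (A zero j) (alt j) _) (∑-cong λ k →
           cong (λ a → A zero j * (alt j * (a * cofactor (minor A j) k))) (sym (A₀≗A₁ (punchIn j k)))))) ⟩
  ∑ (λ j → ∑ (λ k → A zero j * (alt j * (A zero (punchIn j k) * (alt k * E (punchIn j ∘ punchIn k))))))
    ≡⟨ double-expansion (A zero) E (λ {g} {h} g≗h → det-ext {A = λ r c → A (suc (suc r)) (g c)} {λ r c → A (suc (suc r)) (h c)}
         λ r c → cong (A (suc (suc r))) (g≗h c)) ⟩
  0ℤ ∎
  where
  open ≡-Reasoning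
  E : (Fin n → Fin (suc (suc n))) → ℤ
  E g = det (λ r c → A (suc (suc r)) (g c))
  distribute : ∀ {m} x a (f : Vector ℤ m) → x * (a * ∑ f) ≡ ∑ (λ k → x * (a * f k))
  distribute x a f = sym (trans (∑-*ˡ x (λ k → a * f k)) (cong (x *_) (∑-*ˡ a f)))

-- The first argument is the induction hypothesis for the minors. It makes the determinant
-- alternating in the rows below the top one, so the copy of row 0 can be swapped up to row 1.
det-repeat₀ : ∀ {n} → (∀ {r s} {A : Matrix n} → r ≢ s → A r ≗ A s → det A ≡ 0ℤ) →
  ∀ s (A : Matrix (suc n)) → A zero ≗ A (suc s) → det A ≡ 0ℤ
det-repeat₀ det-repeat zero    A A₀≗As = det-repeat₀₁ {A = A} A₀≗As
det-repeat₀ det-repeat (suc s) A A₀≗As = begin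
  det A                ≡⟨ det-ext {A = A} {A zero ∷ᵛ tail A} (λ { zero j → refl ; (suc i) j → refl }) ⟩
  det (A zero ∷ᵛ tail A) ≡⟨ swap det-tail {zero} {suc s} (λ ()) {tail A} {B}
                            (λ j → ≡⇒≗ (sym (≔-at _ s (A (suc zero)))) j)
                            (λ j → refl)
                            (λ { zero 0≢0 _ → contradiction refl 0≢0
                               ; (suc i) _ i≢s → ≡⇒≗ (sym (≔-off _ s (A (suc zero)) (i≢s ∘ cong suc))) }) ⟩
  - det (A zero ∷ᵛ B)  ≡⟨ cong -_ (det-repeat₀₁ {A = A zero ∷ᵛ B} A₀≗As) ⟩
  0ℤ                   ∎
  where
  open ≡-Reasoning
  B = (tail A [ zero ]≔ A (suc (suc s))) [ suc s ]≔ A (suc zero)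
  det-tail : Alternating (λ B → det (A zero ∷ᵛ B))
  det-tail = record
    { multilinear = cons-multilinear (A zero) det-multilinear
    ; repeat      = λ {_} {_} {B} r≢s Br≗Bs → det-zero-minors (A zero ∷ᵛ B) λ j →
                      det-repeat {A = minor (A zero ∷ᵛ B) j} r≢s (λ c → Br≗Bs (punchIn j c))
    }

det-repeat : ∀ {n} {r s : Fin n} {A : Matrix n} → r ≢ s → A r ≗ A s → det A ≡ 0ℤ
det-repeat {suc n} {zero}  {zero}  {A} r≢s Ar≗As = contradiction refl r≢s
det-repeat {suc n} {zero}  {suc s} {A} r≢s Ar≗As =
  det-repeat₀ (λ {_} {_} {B} → det-repeat {A = B}) s A Ar≗As
det-repeat {suc n} {suc r} {zero}  {A} r≢s Ar≗As =
  det-repeat₀ (λ {_} {_} {B} → det-repeat {A = B}) r A (λ j → sym (Ar≗As j))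
det-repeat {suc n} {suc r} {suc s} {A} r≢s Ar≗As =
  det-zero-minors A λ j → det-repeat {A = minor A j} (r≢s ∘ cong suc) (λ c → Ar≗As (punchIn j c))

det-alternating : ∀ {n} → Alternating (det {n})
det-alternating = record { multilinear = det-multilinear ; repeat = λ {r} {s} {A} → det-repeat {A = A} }

-- Row operations and uniqueness of the determinant

∑-single : ∀ {n} (r : Fin n) (f : Vector ℤ n) → (∀ i → i ≢ r → f i ≡ 0ℤ) → ∑ f ≡ f r
∑-single {suc n} r f f≡0 = trans (∑-remove r f)
  (trans (cong (_+_ (f r)) (∑-zero λ i → f≡0 (punchIn r i) (punchInᵢ≢i r i))) (ℤ.+-identityʳ (f r)))

multilinear-sum : ∀ {k n} {f : (Fin k → Vector ℤ n) → ℤ} → Multilinear f →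
  ∀ r {m} (c : Vector ℤ m) (V : Fin m → Vector ℤ n) {C} →
  (∀ j → C r j ≡ ∑ (λ i → c i * V i j)) → f C ≡ ∑ (λ i → c i * f (C [ r ]≔ V i))
-- An empty combination makes row `r` zero, hence `0ℤ` times itself plus `0ℤ` times itself, and
-- linearity gives 0.
multilinear-sum {f = f} ml r {zero} c V {C} row = begin
  f C                   ≡⟨ linear ml r 0ℤ 0ℤ {C} {C} {C} (λ _ _ _ → refl) (λ _ _ _ → refl)
                             (λ j → trans (row j) (trans (∑-empty _) (sym (zeros (C r j) (C r j))))) ⟩
  0ℤ * f C + 0ℤ * f C   ≡⟨ zeros (f C) (f C) ⟩
  0ℤ                    ≡⟨ ∑-empty _ ⟨
  ∑ (λ i → c i * f (C [ r ]≔ V i)) ∎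
  where
  open ≡-Reasoning
  zeros : ∀ x y → 0ℤ * x + 0ℤ * y ≡ 0ℤ
  zeros = solve-∀
multilinear-sum {n = n} {f = f} ml r {suc m} c V {C} row = begin
  f C
    ≡⟨ linear ml r (c zero) 1ℤ {C [ r ]≔ V zero} {B} {C}
         (λ i i≢r → ≡⇒≗ (≔-off C r (V zero) i≢r)) (λ i i≢r → ≡⇒≗ (≔-off C r others i≢r)) split ⟩
  c zero * f (C [ r ]≔ V zero) + 1ℤ * f B
    ≡⟨ cong (_+_ (c zero * f (C [ r ]≔ V zero))) (trans (ℤ.*-identityˡ (f B))
         (multilinear-sum ml r (c ∘ suc) (V ∘ suc) (≡⇒≗ (≔-at C r others)))) ⟩
  c zero * f (C [ r ]≔ V zero) + ∑ (λ i → c (suc i) * f (B [ r ]≔ V (suc i)))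
    ≡⟨ cong (_+_ (c zero * f (C [ r ]≔ V zero)))
         (∑-cong λ i → cong (c (suc i) *_) (ext ml (overwrite (V (suc i))))) ⟩
  c zero * f (C [ r ]≔ V zero) + ∑ (λ i → c (suc i) * f (C [ r ]≔ V (suc i)))
    ≡⟨ ∑-suc _ ⟨
  ∑ (λ i → c i * f (C [ r ]≔ V i)) ∎
  where
  open ≡-Reasoning
  others : Vector ℤ n
  others j = ∑ (λ i → c (suc i) * V (suc i) j)
  B = C [ r ]≔ others
  split : ∀ j → C r j ≡ c zero * (C [ r ]≔ V zero) r j + 1ℤ * B r j
  split j rewrite ≔-at C r (V zero) | ≔-at C r others =
    trans (row j) (trans (∑-suc _) (cong (_+_ (c zero * V zero j)) (sym (ℤ.*-identityˡ (others j)))))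
  overwrite : ∀ v → (B [ r ]≔ v) ≈ₘ (C [ r ]≔ v)
  overwrite v i j with i ≟ r
  ... | yes refl = trans (≡⇒≗ (≔-at B r v) j) (sym (≡⇒≗ (≔-at C r v) j))
  ... | no i≢r   = trans (≡⇒≗ (≔-off B r v i≢r) j)
                     (trans (≡⇒≗ (≔-off C r others i≢r) j) (sym (≡⇒≗ (≔-off C r v i≢r) j)))

-- After expanding row `r`, each summand other than the one for `r` itself has a repeated row.
row-combination : ∀ {k n} {f : (Fin k → Vector ℤ n) → ℤ} → Alternating f →
  ∀ r (c : Vector ℤ k) {M C} → C ≈[ r ] M → (∀ j → C r j ≡ ∑ (λ i → c i * M i j)) → f C ≡ c r * f M
row-combination {f = f} af r c {M} {C} C≈M row = begin
  f C                              ≡⟨ multilinear-sum (multilinear af) r c M row ⟩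
  ∑ (λ i → c i * f (C [ r ]≔ M i)) ≡⟨ ∑-single r _ repeated ⟩
  c r * f (C [ r ]≔ M r)           ≡⟨ cong (c r *_) (ext (multilinear af) restored) ⟩
  c r * f M                        ∎
  where
  open ≡-Reasoning
  repeated : ∀ i → i ≢ r → c i * f (C [ r ]≔ M i) ≡ 0ℤ
  repeated i i≢r = trans (cong (c i *_) (repeat af i≢r λ j →
    trans (≡⇒≗ (≔-off C r (M i) i≢r) j) (trans (C≈M i i≢r j) (sym (≡⇒≗ (≔-at C r (M i)) j)))))
    (ℤ.*-zeroʳ (c i))
  restored : (C [ r ]≔ M r) ≈ₘ M
  restored i j with i ≟ r
  ... | yes refl = ≡⇒≗ (≔-at C r (M r)) j
  ... | no i≢r   = trans (≡⇒≗ (≔-off C r (M r) i≢r) j) (C≈M i i≢r j)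

-- Bringing row `j` to the top takes `j` adjacent transpositions.
cycle : ∀ {k n} {f : (Fin (suc k) → Vector ℤ n) → ℤ} → Alternating f →
  ∀ V j → f (V j ∷ᵛ (V ∘ punchIn j)) ≡ alt j * f V
cycle {f = f} af V zero = trans (ext (multilinear af) λ { zero _ → refl ; (suc i) _ → refl })
  (sym (ℤ.*-identityˡ (f V)))
cycle {suc k} {f = f} af V (suc j) = begin
  f (V (suc j) ∷ᵛ (V ∘ punchIn (suc j)))
    ≡⟨ swap af {zero} {suc zero} (λ ()) (λ _ → refl) (λ _ → refl)
         (λ { zero 0≢0 _ _ → contradiction refl 0≢0
            ; (suc zero) _ 1≢1 _ → contradiction refl 1≢1
            ; (suc (suc i)) _ _ _ → refl }) ⟩
  - f (V zero ∷ᵛ (V (suc j) ∷ᵛ (tail V ∘ punchIn j)))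
    ≡⟨ cong -_ (cycle (cons-alternating (V zero) af) (tail V) j) ⟩
  - (alt j * f (V zero ∷ᵛ tail V))
    ≡⟨ ℤ.neg-distribˡ-* (alt j) (f (V zero ∷ᵛ tail V)) ⟩
  - alt j * f (V zero ∷ᵛ tail V)
    ≡⟨ cong (- alt j *_) (ext (multilinear af) λ { zero _ → refl ; (suc i) _ → refl }) ⟩
  - alt j * f V ∎
  where open ≡-Reasoning

-- `ε` is the sign of `g` if `g` is injective and 0 otherwise. It is chosen before `f` and `V`, so
-- that different alternating functions can be compared through the same factor.
reindex : ∀ {k} (g : Fin k → Fin k) → ∃[ ε ] ∀ {n} {f : (Fin k → Vector ℤ n) → ℤ} →
  Alternating f → ∀ V → f (V ∘ g) ≡ ε * f V
reindex {zero}  g = 1ℤ , λ {_} {f} af V →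
  trans (ext (multilinear af) λ ()) (sym (ℤ.*-identityˡ (f V)))
reindex {suc k} g with any? (λ i → g zero ≟ g (suc i))
... | yes (i , g₀≡gᵢ) = 0ℤ , λ {_} {f} af V →
  trans (repeat af {zero} {suc i} (λ ()) (≡⇒≗ (cong V g₀≡gᵢ))) (sym (ℤ.*-zeroˡ (f V)))
... | no g₀≢ = proj₁ rec * alt (g zero) , λ {n} {f} af V → begin
  f (V ∘ g)
    ≡⟨ ext (multilinear af) (λ { zero _ → refl
         ; (suc i) → ≡⇒≗ (cong V (sym (punchIn-punchOut (λ eq → g₀≢ (i , eq))))) }) ⟩
  f (V (g zero) ∷ᵛ (V ∘ punchIn (g zero) ∘ g′))
    ≡⟨ proj₂ rec (cons-alternating (V (g zero)) af) (V ∘ punchIn (g zero)) ⟩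
  proj₁ rec * f (V (g zero) ∷ᵛ (V ∘ punchIn (g zero)))
    ≡⟨ cong (proj₁ rec *_) (cycle af V (g zero)) ⟩
  proj₁ rec * (alt (g zero) * f V)
    ≡⟨ ℤ.*-assoc (proj₁ rec) (alt (g zero)) (f V) ⟨
  proj₁ rec * alt (g zero) * f V ∎
  where
  open ≡-Reasoning
  g′ : Fin k → Fin k
  g′ i = punchOut (λ eq → g₀≢ (i , eq))
  rec = reindex g′

δ : ∀ {n} → Matrix n
δ i j = if does (i ≟ j) then 1ℤ else 0ℤ

δ-refl : ∀ {n} (i : Fin n) → δ i i ≡ 1ℤ
δ-refl i with i ≟ i
... | yes _  = refl
... | no i≢i = contradiction refl i≢i

δ-≢ : ∀ {n} {i j : Fin n} → i ≢ j → δ i j ≡ 0ℤ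
δ-≢ {i = i} {j} i≢j with i ≟ j
... | yes i≡j = contradiction i≡j i≢j
... | no _    = refl

δ-∑ : ∀ {n} (v : Vector ℤ n) j → v j ≡ ∑ (λ i → v i * δ i j)
δ-∑ v j = sym (trans (∑-single j _ λ i i≢j → trans (cong (v i *_) (δ-≢ i≢j)) (ℤ.*-zeroʳ (v i)))
  (trans (cong (v j *_) (δ-refl j)) (ℤ.*-identityʳ (v j))))

multilinear-unique : ∀ {k n} {f g : (Fin k → Vector ℤ n) → ℤ} → Multilinear f → Multilinear g →
  (∀ (σ : Fin k → Fin n) → f (δ ∘ σ) ≡ g (δ ∘ σ)) → ∀ A → f A ≡ g A
multilinear-unique {zero} mf mg f≡g A =
  trans (ext mf {A} {λ ()} (λ ())) (trans (trans (ext mf (λ ())) (trans (f≡g (λ ())) (ext mg (λ ())))) (ext mg {λ ()} {A} (λ ())))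
multilinear-unique {suc k} {n} {f} {g} mf mg f≡g A = begin
  f A                                        ≡⟨ multilinear-sum mf zero (A zero) δ (δ-∑ (A zero)) ⟩
  ∑ (λ j → A zero j * f (A [ zero ]≔ δ j))   ≡⟨ ∑-cong (λ j → cong (A zero j *_) (begin
    f (A [ zero ]≔ δ j)     ≡⟨ ext mf (head-tail j) ⟩
    f (δ j ∷ᵛ tail A)       ≡⟨ multilinear-unique (cons-multilinear (δ j) mf) (cons-multilinear (δ j) mg) (on-basis j) (tail A) ⟩
    g (δ j ∷ᵛ tail A)       ≡⟨ ext mg (head-tail j) ⟨
    g (A [ zero ]≔ δ j)     ∎)) ⟩
  ∑ (λ j → A zero j * g (A [ zero ]≔ δ j))   ≡⟨ multilinear-sum mg zero (A zero) δ (δ-∑ (A zero)) ⟨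
  g A                                        ∎
  where
  open ≡-Reasoning
  head-tail : ∀ j → (A [ zero ]≔ δ j) ≈ₘ (δ j ∷ᵛ tail A)
  head-tail j zero    _ = refl
  head-tail j (suc i) _ = refl
  on-basis : ∀ j (σ : Fin k → Fin n) → f (δ j ∷ᵛ (δ ∘ σ)) ≡ g (δ j ∷ᵛ (δ ∘ σ))
  on-basis j σ = trans (ext mf λ { zero _ → refl ; (suc i) _ → refl })
    (trans (f≡g (j ∷ᵛ σ)) (ext mg λ { zero _ → refl ; (suc i) _ → refl }))

-- By multilinearity only matrices whose rows are basis vectors matter. Those are reindexed copies
-- of `δ`, and `reindex` scales both values at `δ` by the same factor.
alternating-unique : ∀ {n} {f g : Matrix n → ℤ} → Alternating f → Alternating g →
  f δ ≡ g δ → ∀ A → f A ≡ g A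
alternating-unique af ag fδ≡gδ = multilinear-unique (multilinear af) (multilinear ag) λ σ →
  trans (proj₂ (reindex σ) af δ) (trans (cong (proj₁ (reindex σ) *_) fδ≡gδ) (sym (proj₂ (reindex σ) ag δ)))

-- Relabelling rows and columns together is still alternating in the rows and fixes `δ`, so
-- uniqueness applies without any transpose or product rule.
det-conjugate : ∀ {n} (π : Fin n ↔ Fin n) (A : Matrix n) →
  det (λ i j → A (Inverse.to π i) (Inverse.to π j)) ≡ det A
det-conjugate {n} π = alternating-unique conjugate-alternating det-alternating (det-ext δ-conjugate)
  where
  open Inverse π using (to; from; strictlyInverseˡ; strictlyInverseʳ)
  conjugate : Matrix n → Matrix n
  conjugate A i j = A (to i) (to j)
  to-≢ : ∀ {i r} → i ≢ from r → to i ≢ r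
  to-≢ i≢ eq = i≢ (trans (sym (strictlyInverseʳ _)) (cong from eq))
  from-≢ : ∀ {r s} → r ≢ s → from r ≢ from s
  from-≢ r≢s eq = r≢s (trans (sym (strictlyInverseˡ _)) (trans (cong to eq) (strictlyInverseˡ _)))
  conjugate-alternating : Alternating (λ A → det (conjugate A))
  conjugate-alternating = record
    { multilinear = record
      { ext    = λ {A} {B} A≈B → det-ext {A = conjugate A} {conjugate B} λ i j → A≈B (to i) (to j)
      ; linear = λ r a b {A} {B} {C} A≈C B≈C row →
          det-linear (from r) a b {conjugate A} {conjugate B} {conjugate C}
            (λ i i≢ j → A≈C (to i) (to-≢ i≢) (to j))
            (λ i i≢ j → B≈C (to i) (to-≢ i≢) (to j))
            (λ j → subst (λ s → C s (to j) ≡ a * A s (to j) + b * B s (to j))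
                     (sym (strictlyInverseˡ r)) (row (to j)))
      }
    ; repeat = λ {r} {s} {A} r≢s Ar≗As → det-repeat {A = conjugate A} (from-≢ r≢s) λ j →
        subst (λ a → A a (to j) ≡ A (to (from s)) (to j)) (sym (strictlyInverseˡ r))
          (subst (λ b → A r (to j) ≡ A b (to j)) (sym (strictlyInverseˡ s)) (Ar≗As (to j)))
    }
  δ-conjugate : conjugate δ ≈ₘ δ
  δ-conjugate i j with i ≟ j
  ... | yes refl = δ-refl (to i)
  ... | no i≢j   = δ-≢ λ eq → i≢j (trans (sym (strictlyInverseʳ i)) (trans (cong from eq) (strictlyInverseʳ j)))

-- Kernel vectors of singular matrices

choose-or-all : ∀ {m} {A : Fin m → Set} {B : Set} → (∀ i → A i ⊎ B) → (∀ i → A i) ⊎ B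
choose-or-all {zero}  h = inj₁ λ ()
choose-or-all {suc m} h with h zero | choose-or-all (h ∘ suc)
... | inj₂ b | _      = inj₂ b
... | inj₁ a | inj₂ b = inj₂ b
... | inj₁ a | inj₁ f = inj₁ λ { zero → a ; (suc i) → f i }

-- Exhaustive search over row selections: it supplies an actual nonzero minor when not all of them
-- vanish. The first hypothesis stands in for function extensionality.
all-functions : ∀ {k m} {P : (Fin k → Fin m) → Set} → (∀ {g h} → g ≗ h → P g → P h) →
  (∀ g → Dec (P g)) → (∀ g → P g) ⊎ ∃[ g ] ¬ P g
all-functions {zero} resp P? with P? (λ ())
... | yes p = inj₁ λ g → resp (λ ()) p
... | no ¬p = inj₂ (_ , ¬p)
all-functions {suc k} {m} {P} resp P? with choose-or-all {m} {λ i → ∀ g → P (i ∷ᵛ g)} (λ i → extend i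
  (all-functions {k} {m} {λ g → P (i ∷ᵛ g)} (λ g≗h → resp λ { zero → refl ; (suc c) → g≗h c }) (λ g → P? (i ∷ᵛ g))))
  where
  extend : ∀ i → (∀ g → P (i ∷ᵛ g)) ⊎ (∃[ g ] ¬ P (i ∷ᵛ g)) → (∀ g → P (i ∷ᵛ g)) ⊎ (∃[ g ] ¬ P g)
  extend i (inj₁ p)        = inj₁ p
  extend i (inj₂ (g , ¬p)) = inj₂ (i ∷ᵛ g , ¬p)
... | inj₁ p = inj₁ λ g → resp (λ { zero → refl ; (suc c) → refl }) (p (g zero) (λ c → g (suc c)))
... | inj₂ w = inj₂ w

Nonzero : ∀ {n} → Vector ℤ n → Set
Nonzero v = ∃[ i ] v i ≢ 0ℤ

alt-*-≢0 : ∀ {n} (j : Fin n) {d} → d ≢ 0ℤ → alt j * d ≢ 0ℤ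
alt-*-≢0 zero    {d} d≢0 eq = d≢0 (trans (sym (ℤ.*-identityˡ d)) eq)
alt-*-≢0 (suc j) {d} d≢0 eq = alt-*-≢0 j d≢0 (trans (sym (ℤ.neg-involutive (alt j * d)))
  (cong -_ (trans (ℤ.neg-distribˡ-* (alt j) d) eq)))

-- If some n − 1 rows have a nonzero maximal minor, the cofactors along them form a kernel
-- vector; otherwise the first column can be dropped.
kernel : ∀ {m n} (M : Fin m → Vector ℤ n) → (∀ (g : Fin n → Fin m) → det (M ∘ g) ≡ 0ℤ) →
  ∃[ v ] Nonzero v × (∀ i → ∑ (λ j → M i j * v j) ≡ 0ℤ)
-- Without columns the only minor is the empty determinant 1, which contradicts the hypothesis.
kernel {m} {zero} M minors≡0 with minors≡0 (λ ())
... | ()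
kernel {m} {suc n} M minors≡0 with all-functions {n} {m} {λ g → ∀ j → det (partial g j) ≡ 0ℤ}
  (λ {g} {h} g≗h zero-g j → trans (det-ext {A = partial h j} {partial g j}
    λ r c → cong (λ i → M i (punchIn j c)) (sym (g≗h r))) (zero-g j))
  (λ g → all? (λ j → det (partial g j) ℤ.≟ 0ℤ))
  where
  partial : (Fin n → Fin m) → Fin (suc n) → Matrix n
  partial g j r c = M (g r) (punchIn j c)
... | inj₁ all≡0 = extend (kernel (λ i → tail (M i)) (λ g → all≡0 g zero))
  where
  extend : ∃[ v ] Nonzero v × (∀ i → ∑ (λ j → M i (suc j) * v j) ≡ 0ℤ) →
    ∃[ v ] Nonzero v × (∀ i → ∑ (λ j → M i j * v j) ≡ 0ℤ)
  extend (v , (j , vj≢0) , Mv≡0) = 0ℤ ∷ᵛ v , (suc j , vj≢0) , λ i →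
    trans (∑-suc _) (cong₂ _+_ (ℤ.*-zeroʳ (M i zero)) (Mv≡0 i))
... | inj₂ (g , ¬all≡0) with ¬∀⟶∃¬ (suc n) _ (λ j → det (λ r c → M (g r) (punchIn j c)) ℤ.≟ 0ℤ) ¬all≡0
-- Pairing this cofactor vector with row `i` is the first-row expansion of the determinant with rows
-- `i ∷ᵛ g`, one of the vanishing maximal minors.
... | j , d≢0 = (λ j → alt j * det (λ r c → M (g r) (punchIn j c))) , (j , alt-*-≢0 j d≢0) ,
  λ i → trans (sym (det-expand (M ∘ (i ∷ᵛ g)))) (minors≡0 (i ∷ᵛ g))

singular⇒kernel : ∀ {n} (M : Matrix n) → det M ≡ 0ℤ →
  ∃[ v ] Nonzero v × (∀ i → ∑ (λ j → M i j * v j) ≡ 0ℤ)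
singular⇒kernel M det≡0 = kernel M λ g →
  trans (proj₂ (reindex g) det-alternating M) (trans (cong (proj₁ (reindex g) *_) det≡0) (ℤ.*-zeroʳ (proj₁ (reindex g))))

-- Polynomial functions on the integers

-- The only property of integer polynomial functions that the argument needs.
record Congruential (p : ℤ → ℤ) : Set where
  constructor congruential
  field divides-difference : ∀ x y → (x - y) ∣ (p x - p y)
open Congruential

congruential-ext : ∀ {p q} → (∀ x → p x ≡ q x) → Congruential p → Congruential q
congruential-ext p≡q cp = congruential λ x y →
  subst ((x - y) ∣_) (cong₂ _-_ (p≡q x) (p≡q y)) (divides-difference cp x y)

congruential-const : ∀ c → Congruential (const c)
congruential-const c = congruential λ x y → divides 0ℤ (trans (ℤ.+-inverseʳ c) (sym (ℤ.*-zeroˡ (x - y))))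

congruential-id : Congruential id
congruential-id = congruential λ x y → divides 1ℤ (sym (ℤ.*-identityˡ (x - y)))

congruential-+ : ∀ {p q} → Congruential p → Congruential q → Congruential (λ x → p x + q x)
congruential-+ {p} {q} (congruential cp) (congruential cq) = congruential λ x y →
  subst ((x - y) ∣_) (regroup (p x) (p y) (q x) (q y)) (∣m∣n⇒∣m+n (cp x y) (cq x y))
  where
  regroup : ∀ a b c d → a - b + (c - d) ≡ a + c - (b + d)
  regroup = solve-∀

congruential-* : ∀ p q → Congruential p → Congruential q → Congruential (λ x → p x * q x)
congruential-* p q (congruential cp) (congruential cq) = congruential λ x y → subst ((x - y) ∣_) (regroup (p x) (p y) (q x) (q y))
  (∣m∣n⇒∣m+n (∣n⇒∣m*n (p x) (cq x y)) (∣m⇒∣m*n (q y) (cp x y)))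
  where
  regroup : ∀ a b c d → a * (c - d) + (a - b) * d ≡ a * c - b * d
  regroup = solve-∀

congruential-∑ : ∀ {n} {p : Fin n → ℤ → ℤ} → (∀ i → Congruential (p i)) → Congruential (λ x → ∑ (λ i → p i x))
congruential-∑ {zero}  cp = congruential-ext (λ x → sym (∑-empty _)) (congruential-const 0ℤ)
congruential-∑ {suc n} cp = congruential-ext (λ x → sym (∑-suc _)) (congruential-+ (cp zero) (congruential-∑ (cp ∘ suc)))

congruential-det : ∀ {n} {M : ℤ → Matrix n} → (∀ i j → Congruential (λ x → M x i j)) → Congruential (λ x → det (M x))
congruential-det {zero}      cM = congruential-const 1ℤ
congruential-det {suc n} {M} cM = congruential-ext (λ x → sym (det-expand (M x))) (congruential-∑ λ j →
  congruential-* (λ x → M x zero j) (λ x → cofactor (M x) j) (cM zero j)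
    (congruential-* (const (alt j)) (λ x → det (minor (M x) j)) (congruential-const (alt j))
      (congruential-det {M = λ x → minor (M x) j} λ r c → cM (suc r) (punchIn j c))))

-- If `p` and `q` agree at `y`, then `x - y` divides `p x - q x`. For `y` far enough away, only 0 is
-- divisible by it.
eventually-equal : ∀ {p q} → Congruential p → Congruential q → ∀ B →
  (∀ m → B < m → p (+ m) ≡ q (+ m)) → ∀ x → p x ≡ q x
eventually-equal {p} {q} (congruential cp) (congruential cq) B p≡q x with p x - q x in Deq
... | D with D ℤ.≟ 0ℤ
... | yes refl = ℤ.i-j≡0⇒i≡j (p x) (q x) Deq
... | no D≢0 = contradiction (ℕ.∣⇒≤ {{ℤ.≢-nonZero D≢0}} (∣⇒∣ᵤ y-x∣D)) (ℕ.<⇒≱ D<y-x)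
  where
  -- Large enough to exceed `B`, where agreement begins, and to put `y` at distance more than the
  -- absolute value of `D` from `x`.
  M = suc (ℤ.∣ D ∣ ℕ.+ B) ℕ.+ ℤ.∣ x ∣
  y = + M
  regroup : ∀ a b c → a - c - (b - c) ≡ a - b
  regroup = solve-∀
  difference : p x - p y - (q x - q y) ≡ D
  difference rewrite p≡q M (ℕ.≤-trans (ℕ.s≤s (ℕ.m≤n+m B ℤ.∣ D ∣)) (ℕ.m≤m+n _ ℤ.∣ x ∣)) =
    trans (regroup (p x) (q x) (q y)) Deq
  y-x∣D : (x - y) ∣ D
  y-x∣D = subst ((x - y) ∣_) difference
    (subst ((x - y) ∣_) (cong (_+_ (p x - p y)) (ℤ.-1*i≡-i (q x - q y)))
      (∣m∣n⇒∣m+n (cp x y) (∣n⇒∣m*n -1ℤ (cq x y))))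
  cancel : ∀ x y → x - (x - y) ≡ y
  cancel = solve-∀
  M≤ : M ≤ ℤ.∣ x ∣ ℕ.+ ℤ.∣ x - y ∣
  M≤ = subst (λ z → ℤ.∣ z ∣ ≤ ℤ.∣ x ∣ ℕ.+ ℤ.∣ x - y ∣) (cancel x y) (ℤ.∣i-j∣≤∣i∣+∣j∣ x (x - y))
  D<y-x : ℤ.∣ D ∣ < ℤ.∣ x - y ∣
  D<y-x = ℕ.≤-trans (ℕ.s≤s (ℕ.m≤m+n ℤ.∣ D ∣ B)) (ℕ.+-cancelˡ-≤ ℤ.∣ x ∣ _ _
    (ℕ.≤-trans (ℕ.≤-reflexive (ℕ.+-comm ℤ.∣ x ∣ _)) M≤))

-- Characteristic polynomials of graphs

⟦_⟧ : Bool → ℤ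
⟦ b ⟧ = if b then 1ℤ else 0ℤ

count-∑ : ∀ {n} (p : Fin n → Bool) → + count p ≡ ∑ (λ v → ⟦ p v ⟧)
count-∑ {zero}  p = sym (∑-empty _)
count-∑ {suc n} p = trans (trans (ℤ.pos-+ (if p zero then 1 else 0) _) (cong₂ _+_ (head-term (p zero)) (count-∑ (p ∘ suc))))
  (sym (∑-suc _))
  where
  head-term : ∀ b → + (if b then 1 else 0) ≡ ⟦ b ⟧
  head-term true  = refl
  head-term false = refl

charMatrix : ∀ {n} → Graph n → ℤ → Matrix n
charMatrix G x u v = (if does (u ≟ v) then x else 0ℤ) - laplacian G u v

charMatrix-entry : ∀ {n} (G : Graph n) x u v →
  charMatrix G x u v ≡ (x - + degree G u) * δ u v + ⟦ adj G u v ⟧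
charMatrix-entry G x u v with u ≟ v
... | yes refl rewrite irrefl G u = diagonal x (+ degree G u)
  where
  diagonal : ∀ x d → x - d ≡ (x - d) * 1ℤ + 0ℤ
  diagonal = solve-∀
... | no _ with adj G u v
... | true  = off-diagonal x (+ degree G u) 1ℤ
  where
  off-diagonal : ∀ x d a → 0ℤ - (- a) ≡ (x - d) * 0ℤ + a
  off-diagonal = solve-∀
... | false = off-diagonal x (+ degree G u)
  where
  off-diagonal : ∀ x d → 0ℤ - 0ℤ ≡ (x - d) * 0ℤ + 0ℤ
  off-diagonal = solve-∀

congruential-charPoly : ∀ {n} (G : Graph n) → Congruential (charPolyAt G)
congruential-charPoly G = congruential-det {M = charMatrix G} λ u v →
  congruential-+ (diagonal (does (u ≟ v))) (congruential-const (- laplacian G u v))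
  where
  diagonal : ∀ b → Congruential (λ x → if b then x else 0ℤ)
  diagonal true  = congruential-id
  diagonal false = congruential-const 0ℤ

charPoly-iso : ∀ {n} (G H : Graph n) → G ≅ H → ∀ x → charPolyAt G x ≡ charPolyAt H x
charPoly-iso G H (π , preserves) x = trans
  (det-ext {A = charMatrix G x} {λ u v → charMatrix H x (to u) (to v)} same-entry)
  (det-conjugate π (charMatrix H x))
  where
  open Inverse π using (to; from; strictlyInverseʳ)
  δ-to : ∀ u v → δ u v ≡ δ (to u) (to v)
  δ-to u v with u ≟ v
  ... | yes refl = sym (δ-refl (to u))
  ... | no u≢v   = sym (δ-≢ λ eq → u≢v (trans (sym (strictlyInverseʳ u)) (trans (cong from eq) (strictlyInverseʳ v))))
  same-degree : ∀ u → + degree G u ≡ + degree H (to u)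
  same-degree u = trans (count-∑ (adj G u)) (trans (∑-cong λ v → cong ⟦_⟧ (preserves u v))
    (trans (sym (∑-permute (λ v → ⟦ adj H (to u) v ⟧) π)) (sym (count-∑ (adj H (to u))))))
  same-entry : ∀ u v → charMatrix G x u v ≡ charMatrix H x (to u) (to v)
  same-entry u v rewrite charMatrix-entry G x u v | charMatrix-entry H x (to u) (to v)
    | preserves u v | δ-to u v | same-degree u = refl

factor-zero : ∀ {a b} → a ≢ 0ℤ → a * b ≡ 0ℤ → b ≡ 0ℤ
factor-zero {a} a≢0 ab≡0 with ℤ.i*j≡0⇒i≡0∨j≡0 a ab≡0
... | inj₁ a≡0 = contradiction a≡0 a≢0
... | inj₂ b≡0 = b≡0

-- The equation `L w = x w` written with differences, which lets maxima and complements be treated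
-- term by term. The zero vector is allowed; `Nonzero` is carried separately.
record Eigenvector {n} (G : Graph n) (x : ℤ) (w : Vector ℤ n) : Set where
  constructor is-eigenvector
  field equation : ∀ u → x * w u ≡ ∑ (λ v → ⟦ adj G u v ⟧ * (w u - w v))
open Eigenvector

∑-adjacent-differences : ∀ {n} (G : Graph n) (w : Vector ℤ n) u →
  ∑ (λ v → ⟦ adj G u v ⟧ * (w u - w v)) ≡ w u * + degree G u - ∑ (λ v → ⟦ adj G u v ⟧ * w v)
∑-adjacent-differences G w u = begin
  ∑ (λ v → ⟦ adj G u v ⟧ * (w u - w v))
    ≡⟨ ∑-cong (λ v → distribute ⟦ adj G u v ⟧ (w u) (w v)) ⟩
  ∑ (λ v → w u * ⟦ adj G u v ⟧ + -1ℤ * (⟦ adj G u v ⟧ * w v))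
    ≡⟨ ∑-linear (w u) -1ℤ (λ v → ⟦ adj G u v ⟧) (λ v → ⟦ adj G u v ⟧ * w v) ⟩
  w u * ∑ (λ v → ⟦ adj G u v ⟧) + -1ℤ * ∑ (λ v → ⟦ adj G u v ⟧ * w v)
    ≡⟨ cong₂ _+_ (cong (w u *_) (sym (count-∑ (adj G u)))) (ℤ.-1*i≡-i _) ⟩
  w u * + degree G u - ∑ (λ v → ⟦ adj G u v ⟧ * w v) ∎
  where
  open ≡-Reasoning
  distribute : ∀ a x y → a * (x - y) ≡ x * a + -1ℤ * (a * y)
  distribute = solve-∀

charMatrix-* : ∀ {n} (G : Graph n) x (w : Vector ℤ n) u →
  ∑ (λ v → charMatrix G x u v * w v) ≡ x * w u - ∑ (λ v → ⟦ adj G u v ⟧ * (w u - w v))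
charMatrix-* G x w u = begin
  ∑ (λ v → charMatrix G x u v * w v)
    ≡⟨ ∑-cong (λ v → trans (cong (_* w v) (charMatrix-entry G x u v))
         (distribute (x - + degree G u) (δ u v) ⟦ adj G u v ⟧ (w v))) ⟩
  ∑ (λ v → (x - + degree G u) * (δ u v * w v) + 1ℤ * (⟦ adj G u v ⟧ * w v))
    ≡⟨ ∑-linear (x - + degree G u) 1ℤ (λ v → δ u v * w v) (λ v → ⟦ adj G u v ⟧ * w v) ⟩
  (x - + degree G u) * ∑ (λ v → δ u v * w v) + 1ℤ * ∑ (λ v → ⟦ adj G u v ⟧ * w v)
    ≡⟨ cong (λ s → (x - + degree G u) * s + 1ℤ * ∑ (λ v → ⟦ adj G u v ⟧ * w v)) diagonal ⟩
  (x - + degree G u) * w u + 1ℤ * ∑ (λ v → ⟦ adj G u v ⟧ * w v)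
    ≡⟨ regroup x (+ degree G u) (w u) (∑ (λ v → ⟦ adj G u v ⟧ * w v)) ⟩
  x * w u - (w u * + degree G u - ∑ (λ v → ⟦ adj G u v ⟧ * w v))
    ≡⟨ cong (λ s → x * w u - s) (∑-adjacent-differences G w u) ⟨
  x * w u - ∑ (λ v → ⟦ adj G u v ⟧ * (w u - w v)) ∎
  where
  open ≡-Reasoning
  distribute : ∀ y d a z → (y * d + a) * z ≡ y * (d * z) + 1ℤ * (a * z)
  distribute = solve-∀
  regroup : ∀ x d z s → (x - d) * z + 1ℤ * s ≡ x * z - (z * d - s)
  regroup = solve-∀
  diagonal : ∑ (λ v → δ u v * w v) ≡ w u
  diagonal = trans (∑-single u _ λ v v≢u → trans (cong (_* w v) (δ-≢ (v≢u ∘ sym))) (ℤ.*-zeroˡ (w v)))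
    (trans (cong (_* w u) (δ-refl u)) (ℤ.*-identityˡ (w u)))

eigenvector : ∀ {n} (G : Graph n) x → charPolyAt G x ≡ 0ℤ → ∃[ w ] Nonzero w × Eigenvector G x w
eigenvector G x root with singular⇒kernel (charMatrix G x) root
... | w , w≢0 , Mw≡0 = w , w≢0 , is-eigenvector λ u →
  ℤ.i-j≡0⇒i≡j _ _ (trans (sym (charMatrix-* G x w u)) (Mw≡0 u))

Closed : ∀ {n} {A : Set} → Graph n → (Fin n → A) → Set
Closed G c = ∀ i j → adj G i j ≡ true → c i ≡ c j

-- Since `c` is constant along edges, it may be pulled out of each column of the Laplacian, and
-- columns sum to zero. Thus `c` is a left null vector of the Laplacian.
closed-combination : ∀ {n} (G : Graph n) x (c : Vector ℤ n) → Closed G c →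
  ∀ j → ∑ (λ i → c i * charMatrix G x i j) ≡ x * c j
closed-combination G x c closed j = begin
  ∑ (λ i → c i * charMatrix G x i j)
    ≡⟨ ∑-cong (λ i → trans (cong (c i *_) (charMatrix-entry G x i j))
         (trans (distribute (c i) (x - + degree G i) (δ i j) ⟦ adj G i j ⟧)
           (cong (_+_ (c i * (x - + degree G i) * δ i j)) (across i (adj G i j) refl)))) ⟩
  ∑ (λ i → c i * (x - + degree G i) * δ i j + c j * ⟦ adj G j i ⟧)
    ≡⟨ ∑-+ (λ i → c i * (x - + degree G i) * δ i j) (λ i → c j * ⟦ adj G j i ⟧) ⟩
  ∑ (λ i → c i * (x - + degree G i) * δ i j) + ∑ (λ i → c j * ⟦ adj G j i ⟧)
    ≡⟨ cong₂ _+_ (sym (δ-∑ (λ i → c i * (x - + degree G i)) j))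
         (trans (∑-*ˡ (c j) (λ i → ⟦ adj G j i ⟧)) (cong (c j *_) (sym (count-∑ (adj G j))))) ⟩
  c j * (x - + degree G j) + c j * + degree G j
    ≡⟨ regroup (c j) x (+ degree G j) ⟩
  x * c j ∎
  where
  open ≡-Reasoning
  distribute : ∀ c y d a → c * (y * d + a) ≡ c * y * d + c * a
  distribute = solve-∀
  regroup : ∀ c x d → c * (x - d) + c * d ≡ x * c
  regroup = solve-∀
  across : ∀ i b → adj G i j ≡ b → c i * ⟦ b ⟧ ≡ c j * ⟦ adj G j i ⟧
  across i true  eq rewrite trans (adj-sym G j i) eq = cong (_* 1ℤ) (closed i j eq)
  across i false eq rewrite trans (adj-sym G j i) eq = trans (ℤ.*-zeroʳ (c i)) (sym (ℤ.*-zeroʳ (c j)))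

charPoly-∪ : ∀ {k} (H : Graph k) x → charPolyAt (K₁ ∪ᴳ H) x ≡ x * charPolyAt H x
charPoly-∪ {k} H x = begin
  det M                              ≡⟨ det-expand M ⟩
  ∑ (λ j → M zero j * cofactor M j)  ≡⟨ ∑-single zero _ (λ { zero 0≢0 → contradiction refl 0≢0
                                                           ; (suc j) _ → ℤ.*-zeroˡ (cofactor M (suc j)) }) ⟩
  M zero zero * (1ℤ * charPolyAt H x) ≡⟨ cong₂ _*_ corner (ℤ.*-identityˡ _) ⟩
  x * charPolyAt H x                 ∎
  where
  open ≡-Reasoning
  M = charMatrix (K₁ ∪ᴳ H) x
  isolated : + count {k} (λ _ → false) ≡ 0ℤ
  isolated = trans (count-∑ {k} (λ _ → false)) (∑-zero λ _ → refl)
  corner : x - + count {k} (λ _ → false) ≡ x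
  corner = trans (cong (λ d → x - d) isolated) (ℤ.+-identityʳ x)

∑-const : ∀ n c → ∑ {n} (λ _ → c) ≡ + n * c
∑-const zero    c = trans (∑-empty _) (sym (ℤ.*-zeroˡ c))
∑-const (suc n) c = trans (∑-suc _) (trans (cong (_+_ c) (∑-const n c)) (sym (ℤ.suc-* (+ n) c)))

-- Multiply the top row by `x - 1` and subtract all other rows. Below the corner the matrix is that
-- of `H` at `x - 1`, whose columns sum to `x - 1`, so the new top row vanishes except for
-- `x (x - n)` in the corner, with `n = suc k`.
charPoly-∨ : ∀ {k} (H : Graph k) x →
  (x - 1ℤ) * charPolyAt (K₁ ∨ᴳ H) x ≡ x * (x - + suc k) * charPolyAt H (x - 1ℤ)
charPoly-∨ {k} H x = begin
  (x - 1ℤ) * det M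
    ≡⟨ row-combination det-alternating zero weights {M} {C}
         (λ { zero 0≢0 → contradiction refl 0≢0 ; (suc i) _ _ → refl }) row ⟨
  det C
    ≡⟨ det-expand C ⟩
  ∑ (λ j → C zero j * cofactor C j)
    ≡⟨ ∑-single zero _ (λ { zero 0≢0 → contradiction refl 0≢0
                          ; (suc j) _ → ℤ.*-zeroˡ (cofactor C (suc j)) }) ⟩
  x * (x - + suc k) * (1ℤ * det (minor M zero))
    ≡⟨ cong (x * (x - + suc k) *_) (trans (ℤ.*-identityˡ _)
         (det-ext {A = minor M zero} {charMatrix H (x - 1ℤ)} same-entry)) ⟩
  x * (x - + suc k) * charPolyAt H (x - 1ℤ) ∎
  where
  open ≡-Reasoning
  M = charMatrix (K₁ ∨ᴳ H) x
  weights : Vector ℤ (suc k)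
  weights = (x - 1ℤ) ∷ᵛ const -1ℤ
  C : Matrix (suc k)
  C = ((x * (x - + suc k)) ∷ᵛ const 0ℤ) ∷ᵛ tail M
  same-entry : ∀ r c → minor M zero r c ≡ charMatrix H (x - 1ℤ) r c
  same-entry r c with r ≟ c
  ... | yes refl = trans (cong (λ d → x - d) (ℤ.pos-+ 1 (degree H r))) (regroup x (+ degree H r))
    where
    regroup : ∀ x d → x - (1ℤ + d) ≡ x - 1ℤ - d
    regroup = solve-∀
  ... | no _ = refl
  full : + count {k} (λ _ → true) ≡ + k
  full = trans (count-∑ {k} (λ _ → true)) (trans (∑-const k 1ℤ) (ℤ.*-identityʳ (+ k)))
  row : ∀ j → C zero j ≡ ∑ (λ i → weights i * M i j)
  row zero = sym (begin
    ∑ (λ i → weights i * M i zero)                      ≡⟨ ∑-suc _ ⟩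
    (x - 1ℤ) * (x - + count {k} (λ _ → true)) + ∑ {k} (λ _ → -1ℤ) ≡⟨ cong₂ (λ d s → (x - 1ℤ) * (x - d) + s) full (∑-const k -1ℤ) ⟩
    (x - 1ℤ) * (x - + k) + + k * -1ℤ                    ≡⟨ factor x (+ k) ⟩
    x * (x - (1ℤ + + k))                                ≡⟨ cong (λ d → x * (x - d)) (ℤ.pos-+ 1 k) ⟨
    x * (x - + suc k)                                   ∎)
    where
    factor : ∀ x k → (x - 1ℤ) * (x - k) + k * -1ℤ ≡ x * (x - (1ℤ + k))
    factor = solve-∀
  row (suc j) = sym (begin
    ∑ (λ i → weights i * M i (suc j))
      ≡⟨ ∑-suc _ ⟩
    (x - 1ℤ) * 1ℤ + ∑ (λ i → -1ℤ * minor M zero i j)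
      ≡⟨ cong (_+_ ((x - 1ℤ) * 1ℤ)) (trans (∑-*ˡ -1ℤ (λ i → minor M zero i j))
           (cong (-1ℤ *_) (trans (∑-cong λ i → trans (same-entry i j) (sym (ℤ.*-identityˡ _)))
             (closed-combination H (x - 1ℤ) (const 1ℤ) (λ _ _ _ → refl) j)))) ⟩
    (x - 1ℤ) * 1ℤ + -1ℤ * ((x - 1ℤ) * 1ℤ)
      ≡⟨ cancel (x - 1ℤ) ⟩
    0ℤ ∎)
    where
    cancel : ∀ y → y * 1ℤ + -1ℤ * (y * 1ℤ) ≡ 0ℤ
    cancel = solve-∀

row-factor : ∀ {k n} {f : (Fin k → Vector ℤ n) → ℤ} → Alternating f → ∀ r (c : Vector ℤ k) x {M w} →
  c r ≡ 1ℤ → (∀ j → ∑ (λ i → c i * M i j) ≡ x * w j) → f M ≡ x * f (M [ r ]≔ w)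
row-factor {f = f} af r c x {M} {w} cr≡1 combination = begin
  f M                         ≡⟨ ℤ.*-identityˡ (f M) ⟨
  1ℤ * f M                    ≡⟨ cong (_* f M) cr≡1 ⟨
  c r * f M                   ≡⟨ row-combination af r c {M} {C} (λ i i≢r → ≡⇒≗ (≔-off M r xw i≢r))
                                   (λ j → trans (≡⇒≗ (≔-at M r xw) j) (sym (combination j))) ⟨
  f C                         ≡⟨ linear (multilinear af) r x 0ℤ {A} {A} {C} off off row ⟩
  x * f A + 0ℤ * f A          ≡⟨ drop x (f A) ⟩
  x * f A                     ∎
  where
  open ≡-Reasoning
  drop : ∀ x y → x * y + 0ℤ * y ≡ x * y
  drop = solve-∀
  xw : Vector ℤ _
  xw j = x * w j
  A = M [ r ]≔ w
  C = M [ r ]≔ xw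
  off : A ≈[ r ] C
  off i i≢r = ≡⇒≗ (trans (≔-off M r w i≢r) (sym (≔-off M r xw i≢r)))
  row : ∀ j → C r j ≡ x * A r j + 0ℤ * A r j
  row j rewrite ≔-at M r xw | ≔-at M r w = sym (drop x (w j))

-- Summing the rows on either side of the separation gives `x` times the indicator of that side, so
-- each side contributes a factor `x`. Here `q` may vary arbitrarily with `x`; only divisibility by
-- `x * x` at each integer is used.
charPoly-two-components : ∀ {n} (G : Graph n) (c : Fin n → Bool) → Closed G c →
  ∀ {s t} → c s ≡ true → c t ≡ false → ∀ x → ∃[ q ] charPolyAt G x ≡ q * x * x
charPoly-two-components {n} G c closed {s} {t} cs ct x = det B , (begin
  det M             ≡⟨ row-factor det-alternating s inside x {M} {inside} (cong ⟦_⟧ cs)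
                         (closed-combination G x inside λ i j → cong ⟦_⟧ ∘ closed i j) ⟩
  x * det A         ≡⟨ cong (x *_) (row-factor det-alternating t outside x {A} {outside} (cong (⟦_⟧ ∘ not) ct)
                         (λ j → trans (∑-cong λ i → unchanged i j)
                           (closed-combination G x outside (λ i j → cong (⟦_⟧ ∘ not) ∘ closed i j) j))) ⟩
  x * (x * det B)   ≡⟨ regroup x (det B) ⟩
  det B * x * x     ∎)
  where
  open ≡-Reasoning
  regroup : ∀ x d → x * (x * d) ≡ d * x * x
  regroup = solve-∀
  inside outside : Vector ℤ n
  inside i = ⟦ c i ⟧
  outside i = ⟦ not (c i) ⟧
  M = charMatrix G x
  A = M [ s ]≔ inside
  B = A [ t ]≔ outside
  -- The first replacement touched only row `s`, which has weight 0 in the second combination.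
  unchanged : ∀ i j → outside i * A i j ≡ outside i * M i j
  unchanged i j with i ≟ s
  ... | yes refl rewrite cs = trans (ℤ.*-zeroˡ (A i j)) (sym (ℤ.*-zeroˡ (M i j)))
  ... | no i≢s = cong (outside i *_) (≡⇒≗ (≔-off M s inside i≢s) j)

-- Isolated vertices from eigenvectors

argmax : ∀ {n} (w : Vector ℤ (suc n)) → ∃[ u ] ∀ v → w v ℤ.≤ w u
argmax {zero}  w = zero , λ { zero → ℤ.≤-refl }
argmax {suc n} w with argmax (w ∘ suc)
... | u , max with ℤ.≤-total (w zero) (w (suc u))
... | inj₁ w₀≤wᵤ = suc u , λ { zero → w₀≤wᵤ ; (suc v) → max v }
... | inj₂ wᵤ≤w₀ = zero , λ { zero → ℤ.≤-refl ; (suc v) → ℤ.≤-trans (max v) wᵤ≤w₀ }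

∑-mono : ∀ {n} {f g : Vector ℤ n} → (∀ i → f i ℤ.≤ g i) → ∑ f ℤ.≤ ∑ g
∑-mono {zero}  {f} {g} f≤g = ℤ.≤-reflexive (trans (∑-empty f) (sym (∑-empty g)))
∑-mono {suc n} {f} {g} f≤g rewrite ∑-suc f | ∑-suc g = ℤ.+-mono-≤ (f≤g zero) (∑-mono (f≤g ∘ suc))

∑-nonNegative-zero : ∀ {n} {f : Vector ℤ n} → (∀ i → 0ℤ ℤ.≤ f i) → ∑ f ≡ 0ℤ → ∀ i → f i ≡ 0ℤ
∑-nonNegative-zero {suc n} {f} 0≤f ∑f≡0 i = ℤ.≤-antisym f≤0 (0≤f i)
  where
  rest = ∑ (f ∘ punchIn i)
  0≤rest : 0ℤ ℤ.≤ rest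
  0≤rest = subst (ℤ._≤ rest) (∑-zero λ _ → refl) (∑-mono {f = const 0ℤ} (0≤f ∘ punchIn i))
  f≤0 : f i ℤ.≤ 0ℤ
  f≤0 = subst (f i ℤ.≤_) (trans (sym (∑-remove i f)) ∑f≡0)
    (subst (ℤ._≤ f i + rest) (ℤ.+-identityʳ (f i)) (ℤ.+-monoʳ-≤ (f i) 0≤rest))

-- A vector with no positive entry and sum zero is zero.
positive-max : ∀ {n} (w : Vector ℤ (suc n)) → Nonzero w → ∑ w ≡ 0ℤ →
  ∃[ u ] 0ℤ ℤ.< w u × (∀ v → w v ℤ.≤ w u)
positive-max w (i , wi≢0) ∑w≡0 with argmax w
... | u , max with 0ℤ ℤ.<? w u
... | yes 0<wᵤ = u , 0<wᵤ , max
... | no 0≮wᵤ  = contradiction (trans (sym (ℤ.neg-involutive (w i))) (cong -_ (negated≡0 i))) wi≢0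
  where
  negated≡0 : ∀ v → - w v ≡ 0ℤ
  negated≡0 = ∑-nonNegative-zero
    (λ v → ℤ.neg-mono-≤ (ℤ.≤-trans (max v) (ℤ.≮⇒≥ 0≮wᵤ)))
    (trans (∑-cong λ v → sym (ℤ.-1*i≡-i (w v))) (trans (∑-*ˡ -1ℤ w) (trans (cong (-1ℤ *_) ∑w≡0) (ℤ.*-zeroʳ -1ℤ))))

-- Evaluate `c (xI - L) w` in two ways: acting on `c` it is `x` times the pairing of `c` with `w`,
-- acting on `w` it is 0.
closed-orthogonal : ∀ {n} (G : Graph n) {x} {w : Vector ℤ n} → Eigenvector G x w → x ≢ 0ℤ →
  (c : Vector ℤ n) → Closed G c → ∑ (λ j → c j * w j) ≡ 0ℤ
closed-orthogonal G {x} {w} eigen x≢0 c closed = factor-zero x≢0 vanishes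
  where
  open ≡-Reasoning
  M = charMatrix G x
  vanishes : x * ∑ (λ j → c j * w j) ≡ 0ℤ
  vanishes = begin
    x * ∑ (λ j → c j * w j)
      ≡⟨ ∑-*ˡ x (λ j → c j * w j) ⟨
    ∑ (λ j → x * (c j * w j))
      ≡⟨ ∑-cong (λ j → trans (sym (ℤ.*-assoc x (c j) (w j)))
           (trans (cong (_* w j) (sym (closed-combination G x c closed j))) (*-distribʳ-∑ (λ i → c i * M i j) (w j)))) ⟩
    ∑ (λ j → ∑ (λ i → c i * M i j * w j))
      ≡⟨ ∑-swap (λ j i → c i * M i j * w j) ⟩
    ∑ (λ i → ∑ (λ j → c i * M i j * w j))
      ≡⟨ ∑-zero (λ i → trans (∑-cong λ j → ℤ.*-assoc (c i) (M i j) (w j))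
           (trans (∑-*ˡ (c i) (λ j → M i j * w j)) (trans (cong (c i *_) (Mw≡0 i)) (ℤ.*-zeroʳ (c i))))) ⟩
    0ℤ ∎
    where
    *-distribʳ-∑ : ∀ {m} (f : Vector ℤ m) y → ∑ f * y ≡ ∑ (λ i → f i * y)
    *-distribʳ-∑ f y = trans (ℤ.*-comm (∑ f) y) (trans (sym (∑-*ˡ y f)) (∑-cong λ i → ℤ.*-comm y (f i)))
    Mw≡0 : ∀ i → ∑ (λ j → M i j * w j) ≡ 0ℤ
    Mw≡0 i = trans (charMatrix-* G x w i) (ℤ.i≡j⇒i-j≡0 (equation eigen i))

eigenvector-sum : ∀ {n} (G : Graph n) {x} {w : Vector ℤ n} → Eigenvector G x w → x ≢ 0ℤ → ∑ w ≡ 0ℤ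
eigenvector-sum G {w = w} eigen x≢0 = trans (∑-cong λ j → sym (ℤ.*-identityˡ (w j)))
  (closed-orthogonal G eigen x≢0 (const 1ℤ) λ _ _ _ → refl)

⟦⟧-nonNegative : ∀ b {x} → 0ℤ ℤ.≤ x → 0ℤ ℤ.≤ ⟦ b ⟧ * x
⟦⟧-nonNegative true  {x} 0≤x rewrite ℤ.*-identityˡ x = 0≤x
⟦⟧-nonNegative false {x} 0≤x rewrite ℤ.*-zeroˡ x = ℤ.≤-refl

Separation : ∀ {n} → Graph n → Set
Separation {n} G = Σ[ c ∈ (Fin n → Bool) ] Closed G c × (∃[ s ] c s ≡ true) × (∃[ t ] c t ≡ false)

-- Maximum principle: at a maximal vertex the differences to the neighbours are nonnegative and sum
-- to 0, so the neighbours are maximal too. The zero sum rules out a constant vector, so some vertex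
-- is not maximal.
harmonic⇒separation : ∀ {n} (G : Graph (suc n)) {a : Vector ℤ (suc n)} → Nonzero a → ∑ a ≡ 0ℤ →
  Eigenvector G 0ℤ a → Separation G
harmonic⇒separation {n} G {a} a≢0 ∑a≡0 eigen with positive-max a a≢0 ∑a≡0
... | u , 0<aᵤ , max with ¬∀⟶∃¬ (suc n) _ (λ v → a v ℤ.≟ a u) ¬constant
  where
  ¬constant : ¬ (∀ v → a v ≡ a u)
  ¬constant a≡aᵤ with ℤ.i*j≡0⇒i≡0∨j≡0 (+ suc n) (trans (sym (∑-const (suc n) (a u))) (trans (∑-cong (sym ∘ a≡aᵤ)) ∑a≡0))
  ... | inj₂ aᵤ≡0 = ℤ.<⇒≢ 0<aᵤ (sym aᵤ≡0)
... | t , aₜ≢aᵤ = c , closed , (u , dec-true (a u ℤ.≟ a u) refl) , (t , dec-false (a t ℤ.≟ a u) aₜ≢aᵤ)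
  where
  c : Fin (suc n) → Bool
  c v = does (a v ℤ.≟ a u)
  spreads : ∀ i j → adj G i j ≡ true → a i ≡ a u → a j ≡ a u
  spreads i j ij aᵢ≡aᵤ = trans (sym (ℤ.i-j≡0⇒i≡j (a i) (a j) (trans (sym (ℤ.*-identityˡ (a i - a j)))
    (subst (λ b → ⟦ b ⟧ * (a i - a j) ≡ 0ℤ) ij (terms≡0 j))))) aᵢ≡aᵤ
    where
    terms≡0 : ∀ v → ⟦ adj G i v ⟧ * (a i - a v) ≡ 0ℤ
    terms≡0 = ∑-nonNegative-zero
      (λ v → ⟦⟧-nonNegative (adj G i v) (ℤ.i≤j⇒0≤j-i (subst (a v ℤ.≤_) (sym aᵢ≡aᵤ) (max v))))
      (trans (sym (equation eigen i)) (ℤ.*-zeroˡ (a i)))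
  closed : Closed G c
  closed i j ij with a i ℤ.≟ a u | a j ℤ.≟ a u
  ... | yes _     | yes _     = refl
  ... | no _      | no _      = refl
  ... | yes aᵢ≡aᵤ | no aⱼ≢aᵤ  = contradiction (spreads i j ij aᵢ≡aᵤ) aⱼ≢aᵤ
  ... | no aᵢ≢aᵤ  | yes aⱼ≡aᵤ = contradiction (spreads j i (trans (adj-sym G j i) ij) aⱼ≡aᵤ) aᵢ≢aᵤ

-- The Laplacian of the complete graph acts as `n` on vectors with sum zero.
∑-differences : ∀ {n} (w : Vector ℤ n) → ∑ w ≡ 0ℤ → ∀ u → ∑ (λ v → w u - w v) ≡ + n * w u
∑-differences {n} w ∑w≡0 u = begin
  ∑ (λ v → w u - w v)                  ≡⟨ ∑-cong (λ v → cong (_+_ (w u)) (sym (ℤ.-1*i≡-i (w v)))) ⟩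
  ∑ (λ v → w u + -1ℤ * w v)            ≡⟨ ∑-+ (const (w u)) (λ v → -1ℤ * w v) ⟩
  ∑ {n} (const (w u)) + ∑ (λ v → -1ℤ * w v)
    ≡⟨ cong₂ _+_ (∑-const n (w u)) (trans (∑-*ˡ -1ℤ w) (trans (cong (-1ℤ *_) ∑w≡0) (ℤ.*-zeroʳ -1ℤ))) ⟩
  + n * w u + 0ℤ                       ≡⟨ ℤ.+-identityʳ _ ⟩
  + n * w u                            ∎
  where open ≡-Reasoning

-- If w is largest at u, the vertices on the other side T of u are non-neighbours of u, and
-- Σ_{v∈T} w v = 0. Hence k w(u) + |T| w(u) ≤ Σ_v (w u − w v) = (k + 1) w(u), so |T| ≤ 1.
far-side-unique : ∀ {k} (G : Graph (suc k)) (c : Fin (suc k) → Bool) → Closed G c →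
  k ≢ 0 → (w : Vector ℤ (suc k)) → Eigenvector G (+ k) w → ∀ u → 0ℤ ℤ.< w u → (∀ v → w v ℤ.≤ w u) →
  ∀ p v → c u xor c p ≡ true → c u xor c v ≡ true → p ≡ v
far-side-unique {k} G c closed k≢0 w eigen u 0<wᵤ max p v cp cv =
  decidable-stable (p ≟ v) λ p≢v → ℤ.<⇒≱ (too-many p≢v) ∑τ-bound
  where
  τ : Vector ℤ (suc k)
  τ v = ⟦ c u xor c v ⟧
  d : Vector ℤ (suc k)
  d v = w u - w v
  +k≢0 = k≢0 ∘ ℤ.+-injective
  ∑τw≡0 : ∑ (λ v → τ v * w v) ≡ 0ℤ
  ∑τw≡0 = closed-orthogonal G eigen +k≢0 τ λ i j ij → cong (λ b → ⟦ c u xor b ⟧) (closed i j ij)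
  ∑τd : ∑ (λ v → τ v * d v) ≡ ∑ τ * w u
  ∑τd = begin
    ∑ (λ v → τ v * d v)                       ≡⟨ ∑-cong (λ v → distribute (τ v) (w u) (w v)) ⟩
    ∑ (λ v → w u * τ v + -1ℤ * (τ v * w v))   ≡⟨ ∑-linear (w u) -1ℤ τ (λ v → τ v * w v) ⟩
    w u * ∑ τ + -1ℤ * ∑ (λ v → τ v * w v)     ≡⟨ cong (λ z → w u * ∑ τ + -1ℤ * z) ∑τw≡0 ⟩
    w u * ∑ τ + -1ℤ * 0ℤ                      ≡⟨ regroup (w u) (∑ τ) ⟩
    ∑ τ * w u                                 ∎
    where
    open ≡-Reasoning
    distribute : ∀ a x y → a * (x - y) ≡ x * a + -1ℤ * (a * y)
    distribute = solve-∀
    regroup : ∀ x y → x * y + -1ℤ * 0ℤ ≡ y * x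
    regroup = solve-∀
  -- Neighbours of `u` lie on the side of `u`, so at most one of the two coefficients is 1. Where
  -- both are 0, maximality makes `d v` nonnegative.
  termwise : ∀ v → τ v * d v + ⟦ adj G u v ⟧ * d v ℤ.≤ d v
  termwise v with adj G u v in uv
  ... | true rewrite sym (closed u v uv) | Bool.xor-same (c u) = ℤ.≤-reflexive (unit (d v))
    where
    unit : ∀ x → 0ℤ * x + 1ℤ * x ≡ x
    unit = solve-∀
  ... | false with c u xor c v
  ... | true  = ℤ.≤-reflexive (unit (d v))
    where
    unit : ∀ x → 1ℤ * x + 0ℤ * x ≡ x
    unit = solve-∀
  ... | false = subst (ℤ._≤ d v) (sym (vanish (d v))) (ℤ.i≤j⇒0≤j-i (max v))
    where
    vanish : ∀ x → 0ℤ * x + 0ℤ * x ≡ 0ℤ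
    vanish = solve-∀
  ∑τ-bound : ∑ τ * w u ℤ.≤ w u
  ∑τ-bound = subst₂ ℤ._≤_ (cancel (∑ τ * w u) (+ k * w u)) (cancel (w u) (+ k * w u)) (ℤ.+-monoˡ-≤ (- (+ k * w u)) (begin
    ∑ τ * w u + + k * w u
      ≡⟨ cong₂ _+_ (sym ∑τd) (equation eigen u) ⟩
    ∑ (λ v → τ v * d v) + ∑ (λ v → ⟦ adj G u v ⟧ * d v)
      ≡⟨ ∑-+ (λ v → τ v * d v) (λ v → ⟦ adj G u v ⟧ * d v) ⟨
    ∑ (λ v → τ v * d v + ⟦ adj G u v ⟧ * d v)
      ≤⟨ ∑-mono termwise ⟩
    ∑ d
      ≡⟨ ∑-differences w (eigenvector-sum G eigen +k≢0) u ⟩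
    + suc k * w u
      ≡⟨ ℤ.suc-* (+ k) (w u) ⟩
    w u + + k * w u ∎))
    where
    open ℤ.≤-Reasoning
    cancel : ∀ a b → a + b + - b ≡ a
    cancel = solve-∀
  too-many : p ≢ v → w u ℤ.< ∑ τ * w u
  too-many p≢v = begin-strict
    w u                         ≡⟨ ℤ.+-identityˡ (w u) ⟨
    0ℤ + w u                    <⟨ ℤ.+-monoˡ-< (w u) 0<wᵤ ⟩
    w u + w u                   ≡⟨ double (w u) ⟩
    (1ℤ + 1ℤ) * w u             ≡⟨ cong (_* w u) (cong₂ _+_ (δ-∑ (const 1ℤ) p) (δ-∑ (const 1ℤ) v)) ⟩
    (∑ (λ i → 1ℤ * δ i p) + ∑ (λ i → 1ℤ * δ i v)) * w u ≡⟨ cong (_* w u) (∑-+ (λ i → 1ℤ * δ i p) (λ i → 1ℤ * δ i v)) ⟨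
    ∑ (λ i → 1ℤ * δ i p + 1ℤ * δ i v) * w u ≤⟨ ℤ.*-monoʳ-≤-nonNeg (w u) {{ℤ.nonNegative (ℤ.<⇒≤ 0<wᵤ)}} (∑-mono indicator) ⟩
    ∑ τ * w u                   ∎
    where
    open ℤ.≤-Reasoning
    double : ∀ x → x + x ≡ (1ℤ + 1ℤ) * x
    double = solve-∀
    -- Two distinct far vertices already give `∑ τ` at least 2, against the bound `∑ τ * w u ≤ w u`
    -- with `w u` positive.
    indicator : ∀ i → 1ℤ * δ i p + 1ℤ * δ i v ℤ.≤ τ i
    indicator i with i ≟ p | i ≟ v
    ... | yes refl | yes p≡v  = contradiction p≡v p≢v
    ... | yes refl | no _     rewrite cp = ℤ.≤-refl
    ... | no _     | yes refl rewrite cv = ℤ.≤-refl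
    ... | no _     | no _     with c u xor c i
    ... | true  = ℤ.+≤+ ℕ.z≤n
    ... | false = ℤ.≤-refl

opposite-vertex : ∀ {n} (c : Fin n → Bool) {s t} → c s ≡ true → c t ≡ false → ∀ b → ∃[ p ] b xor c p ≡ true
opposite-vertex c {s} {t} cs ct true  = t , cong not ct
opposite-vertex c {s} {t} cs ct false = s , cs

-- A vertex `p` across from the maximum of `w` is alone on its side. A neighbour would share that
-- side, hence equal `p`, and loops are excluded.
separation⇒isolated : ∀ {k} (G : Graph (suc k)) → Separation G → k ≢ 0 →
  ∀ {w} → Nonzero w → Eigenvector G (+ k) w → ∃[ p ] ∀ v → adj G p v ≡ false
separation⇒isolated {k} G (c , closed , (s , cs) , (t , ct)) k≢0 {w} w≢0 eigen =
  let u , 0<wᵤ , max = positive-max w w≢0 (eigenvector-sum G eigen (k≢0 ∘ ℤ.+-injective))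
      p , cp         = opposite-vertex c cs ct (c u)
      unique         = λ v → far-side-unique G c closed k≢0 w eigen u 0<wᵤ max p v cp
  in p , λ v → isolated p v λ pv → unique v (trans (cong (c u xor_) (sym (closed p v pv))) cp)
  where
  isolated : ∀ p v → (adj G p v ≡ true → p ≡ v) → adj G p v ≡ false
  isolated p v loop with adj G p v in pv
  ... | false = refl
  ... | true with refl ← loop refl = trans (sym pv) (irrefl G p)

-- Complements and vertex deletion

complement : ∀ {n} → Graph n → Graph n
complement G = record
  { adj    = λ u v → if does (u ≟ v) then false else not (adj G u v)
  ; sym    = symmetric
  ; irrefl = λ u → cong (λ b → if b then false else not (adj G u u)) (dec-true (u ≟ u) refl)
  }
  where
  symmetric : ∀ u v → (if does (u ≟ v) then false else not (adj G u v)) ≡ (if does (v ≟ u) then false else not (adj G v u))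
  symmetric u v with u ≟ v | v ≟ u
  ... | yes _   | yes _   = refl
  ... | yes u≡v | no v≢u  = contradiction (sym u≡v) v≢u
  ... | no u≢v  | yes v≡u = contradiction (sym v≡u) u≢v
  ... | no _    | no _    = cong not (adj-sym G u v)

-- The Laplacians of a graph and its complement add up to that of the complete graph, which is `n`
-- on vectors with sum zero.
complement-eigenvector : ∀ {n} (G : Graph n) {x} {w : Vector ℤ n} → Eigenvector G x w → ∑ w ≡ 0ℤ →
  Eigenvector (complement G) (+ n - x) w
complement-eigenvector {n} G {x} {w} eigen ∑w≡0 = is-eigenvector λ u → begin
  (+ n - x) * w u
    ≡⟨ distribute (+ n) x (w u) ⟩
  + n * w u - x * w u
    ≡⟨ cong₂ _-_ (sym (∑-differences w ∑w≡0 u)) (equation eigen u) ⟩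
  ∑ (λ v → w u - w v) - ∑ (λ v → ⟦ adj G u v ⟧ * (w u - w v))
    ≡⟨ cong (_- ∑ (λ v → ⟦ adj G u v ⟧ * (w u - w v))) (trans (∑-cong (termwise u))
         (∑-+ (λ v → ⟦ adj (complement G) u v ⟧ * (w u - w v)) (λ v → ⟦ adj G u v ⟧ * (w u - w v)))) ⟩
  ∑ (λ v → ⟦ adj (complement G) u v ⟧ * (w u - w v)) + ∑ (λ v → ⟦ adj G u v ⟧ * (w u - w v))
    - ∑ (λ v → ⟦ adj G u v ⟧ * (w u - w v))
    ≡⟨ cancel (∑ (λ v → ⟦ adj (complement G) u v ⟧ * (w u - w v))) (∑ (λ v → ⟦ adj G u v ⟧ * (w u - w v))) ⟩
  ∑ (λ v → ⟦ adj (complement G) u v ⟧ * (w u - w v)) ∎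
  where
  open ≡-Reasoning
  distribute : ∀ n x y → (n - x) * y ≡ n * y - x * y
  distribute = solve-∀
  cancel : ∀ a b → a + b - b ≡ a
  cancel = solve-∀
  diagonal : ∀ y a → y - y ≡ 0ℤ * (y - y) + a * (y - y)
  diagonal = solve-∀
  neighbour : ∀ y → y ≡ 0ℤ * y + 1ℤ * y
  neighbour = solve-∀
  non-neighbour : ∀ y → y ≡ 1ℤ * y + 0ℤ * y
  non-neighbour = solve-∀
  termwise : ∀ u v → w u - w v ≡ ⟦ adj (complement G) u v ⟧ * (w u - w v) + ⟦ adj G u v ⟧ * (w u - w v)
  termwise u v with u ≟ v
  ... | yes refl = diagonal (w u) ⟦ adj G u u ⟧
  ... | no _ with adj G u v
  ... | true  = neighbour (w u - w v)
  ... | false = non-neighbour (w u - w v)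

delete : ∀ {n} → Graph (suc n) → Fin (suc n) → Graph n
delete G u = record
  { adj    = λ i j → adj G (punchIn u i) (punchIn u j)
  ; sym    = λ i j → adj-sym G (punchIn u i) (punchIn u j)
  ; irrefl = λ i → irrefl G (punchIn u i)
  }

Dominating : ∀ {n} → Graph n → Fin n → Set
Dominating G u = ∀ v → u ≢ v → adj G u v ≡ true

-- At a dominating vertex the eigenvector equation is that of the complete graph: `x * w u` equals
-- `n * w u`.
dominating-zero : ∀ {n} (G : Graph n) {u} → Dominating G u → ∀ {x w} → Eigenvector G x w →
  x ≢ 0ℤ → x ≢ + n → w u ≡ 0ℤ
dominating-zero {n} G {u} dominating {x} {w} eigen x≢0 x≢n = factor-zero (x≢n ∘ ℤ.i-j≡0⇒i≡j x (+ n))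
  (trans (distribute x (+ n) (w u)) (ℤ.i≡j⇒i-j≡0 same))
  where
  distribute : ∀ x n y → (x - n) * y ≡ x * y - n * y
  distribute = solve-∀
  termwise : ∀ v → ⟦ adj G u v ⟧ * (w u - w v) ≡ w u - w v
  termwise v with u ≟ v
  ... | yes refl = trans (cong (⟦ adj G u u ⟧ *_) (ℤ.+-inverseʳ (w u)))
                     (trans (ℤ.*-zeroʳ ⟦ adj G u u ⟧) (sym (ℤ.+-inverseʳ (w u))))
  ... | no u≢v   = trans (cong (λ b → ⟦ b ⟧ * (w u - w v)) (dominating v u≢v)) (ℤ.*-identityˡ (w u - w v))
  same : x * w u ≡ + n * w u
  same = trans (equation eigen u) (trans (∑-cong termwise) (∑-differences w (eigenvector-sum G eigen x≢0) u))

-- Each remaining vertex loses exactly its edge to `u`; as `w u` is 0, that edge contributed one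
-- copy of the entry at the vertex.
delete-eigenvector : ∀ {n} (G : Graph (suc n)) {u} → Dominating G u → ∀ {x w} → Eigenvector G x w →
  w u ≡ 0ℤ → Eigenvector (delete G u) (x - 1ℤ) (w ∘ punchIn u)
delete-eigenvector G {u} dominating {x} {w} eigen wᵤ≡0 = is-eigenvector λ i → begin
  (x - 1ℤ) * w (punchIn u i)
    ≡⟨ distribute x (w (punchIn u i)) ⟩
  x * w (punchIn u i) - w (punchIn u i)
    ≡⟨ cong (_- w (punchIn u i)) (trans (equation eigen (punchIn u i)) (∑-remove u _)) ⟩
  ⟦ adj G (punchIn u i) u ⟧ * (w (punchIn u i) - w u) + rest i - w (punchIn u i)
    ≡⟨ cong₂ (λ b y → ⟦ b ⟧ * (w (punchIn u i) - y) + rest i - w (punchIn u i))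
         (trans (adj-sym G (punchIn u i) u) (dominating (punchIn u i) (punchInᵢ≢i u i ∘ sym))) wᵤ≡0 ⟩
  1ℤ * (w (punchIn u i) - 0ℤ) + rest i - w (punchIn u i)
    ≡⟨ cancel (w (punchIn u i)) (rest i) ⟩
  rest i ∎
  where
  open ≡-Reasoning
  rest : Vector ℤ _
  rest i = ∑ (λ j → ⟦ adj G (punchIn u i) (punchIn u j) ⟧ * (w (punchIn u i) - w (punchIn u j)))
  distribute : ∀ x y → (x - 1ℤ) * y ≡ x * y - y
  distribute = solve-∀
  cancel : ∀ y r → 1ℤ * (y - 0ℤ) + r - y ≡ r
  cancel = solve-∀

delete-nonzero : ∀ {n} {w : Vector ℤ (suc n)} {u} → w u ≡ 0ℤ → Nonzero w → Nonzero (w ∘ punchIn u)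
delete-nonzero {w = w} {u} wᵤ≡0 (i , wᵢ≢0) = punchOut u≢i , λ eq →
  wᵢ≢0 (trans (cong w (sym (punchIn-punchOut u≢i))) eq)
  where
  u≢i : u ≢ i
  u≢i refl = wᵢ≢0 wᵤ≡0

delete-sum : ∀ {n} {w : Vector ℤ (suc n)} {u} → w u ≡ 0ℤ → ∑ w ≡ 0ℤ → ∑ (w ∘ punchIn u) ≡ 0ℤ
delete-sum {w = w} {u} wᵤ≡0 ∑w≡0 = trans (sym (ℤ.+-identityˡ _))
  (trans (cong (_+ ∑ (w ∘ punchIn u)) (sym wᵤ≡0)) (trans (sym (∑-remove u w)) ∑w≡0))

punchIn-cover : ∀ {n} (u a : Fin (suc n)) → u ≡ a ⊎ ∃[ i ] punchIn u i ≡ a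
punchIn-cover u a with u ≟ a
... | yes u≡a = inj₁ u≡a
... | no u≢a  = inj₂ (punchOut u≢a , punchIn-punchOut u≢a)

insert-self : ∀ {m n} i j (π : Fin m ↔ Fin n) → insert i j π ⟨$⟩ʳ i ≡ j
insert-self i j π with i ≟ i
... | yes _  = refl
... | no i≢i = contradiction refl i≢i

delete-≅ : ∀ {m n} (G : Graph (suc m)) u (K : Graph (suc n)) → (iso : delete G u ≅ delete K zero) →
  (∀ i → adj G u (punchIn u i) ≡ adj K zero (suc (Inverse.to (proj₁ iso) i))) → G ≅ K
delete-≅ G u K (π , preserves) spokes = insert u zero π , preserves′
  where
  preserves′ : ∀ a b → adj G a b ≡ adj K (insert u zero π ⟨$⟩ʳ a) (insert u zero π ⟨$⟩ʳ b)
  preserves′ a b with punchIn-cover u a | punchIn-cover u b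
  ... | inj₁ refl | inj₁ refl rewrite insert-self u zero π = trans (irrefl G u) (sym (irrefl K zero))
  ... | inj₁ refl | inj₂ (j , refl) rewrite insert-self u zero π | insert-punchIn u zero π j = spokes j
  ... | inj₂ (i , refl) | inj₁ refl rewrite insert-self u zero π | insert-punchIn u zero π i =
    trans (adj-sym G _ u) (trans (spokes i) (adj-sym K zero _))
  ... | inj₂ (i , refl) | inj₂ (j , refl) rewrite insert-punchIn u zero π i | insert-punchIn u zero π j = preserves i j

dominating-isolated-≅ : ∀ {k} (G : Graph (suc (suc k))) {u} → Dominating G u →
  ∀ {t} → (∀ v → adj (delete G u) t v ≡ false) → G ≅ (K₁ ∨ᴳ (K₁ ∪ᴳ delete (delete G u) t))
dominating-isolated-≅ G {u} dominating {t} isolated =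
  delete-≅ G u (K₁ ∨ᴳ (K₁ ∪ᴳ H))
    (delete-≅ (delete G u) t (delete (K₁ ∨ᴳ (K₁ ∪ᴳ H)) zero)
      -- Removing the apex and the isolated vertex from the cone gives back `H` by computation, so
      -- the identity is the innermost isomorphism.
      (Identity.↔-id _ , λ _ _ → refl) (λ i → isolated (punchIn t i)))
    (λ i → dominating (punchIn u i) (punchInᵢ≢i u i ∘ sym))
  where H = delete (delete G u) t

-- Connectivity from a simple zero

reach-∷ʳ : ∀ {n} {G : Graph n} {u v w} → Reach G u v → adj G v w ≡ true → Reach G u w
reach-∷ʳ here          vw = step vw here
reach-∷ʳ (step uv′ r)  vw = step uv′ (reach-∷ʳ r vw)

-- Enlarge the set of reached vertices while some edge leaves it. Once none does, the set is
-- everything or its indicator is a separation.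
reachable-or-separated : ∀ {n} (G : Graph n) s → (∀ t → Reach G s t) ⊎ Separation G
reachable-or-separated {n} G s = grow ⁅ s ⁆ (⊃-wellFounded ⁅ s ⁆) (x∈⁅x⁆ s)
  (λ v∈ → subst (Reach G s) (sym (x∈⁅y⁆⇒x≡y s v∈)) here)
  where
  grow : ∀ (p : Subset n) → Acc _⊃_ p → s ∈ p → (∀ {v} → v ∈ p → Reach G s v) →
    (∀ t → Reach G s t) ⊎ Separation G
  grow p (acc rec) s∈p reached
    with any? (λ i → any? (λ j → (i ∈? p) ×-dec ¬? (j ∈? p) ×-dec (adj G i j Bool.≟ true)))
  ... | yes (i , j , i∈p , j∉p , ij) = grow (p ∪ ⁅ j ⁆) (rec (p⊆p∪q ⁅ j ⁆ , j , q⊆p∪q p ⁅ j ⁆ (x∈⁅x⁆ j) , j∉p))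
    (p⊆p∪q ⁅ j ⁆ s∈p) reached′
    where
    reached′ : ∀ {v} → v ∈ (p ∪ ⁅ j ⁆) → Reach G s v
    reached′ v∈ with x∈p∪q⁻ p ⁅ j ⁆ v∈
    ... | inj₁ v∈p = reached v∈p
    ... | inj₂ v∈j with refl ← x∈⁅y⁆⇒x≡y j v∈j = reach-∷ʳ (reached i∈p) ij
  ... | no no-edge with all? (_∈? p)
  ... | yes all∈p = inj₁ (λ t → reached (all∈p t))
  ... | no ¬all∈p with ¬∀⟶∃¬ n _ (_∈? p) ¬all∈p
  ... | t , t∉p = inj₂ ((λ v → does (v ∈? p)) , closed , (s , dec-true (s ∈? p) s∈p) , (t , dec-false (t ∈? p) t∉p))
    where
    closed : Closed G (λ v → does (v ∈? p))
    closed i j ij with i ∈? p | j ∈? p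
    ... | yes _   | yes _   = refl
    ... | no _    | no _    = refl
    ... | yes i∈p | no j∉p  = contradiction (i , j , i∈p , j∉p , ij) no-edge
    ... | no i∉p  | yes j∈p = contradiction (j , i , j∈p , i∉p , trans (adj-sym G j i) ij) no-edge

-- A separation makes `x * x` divide the value at `x`, so `x` divides `r x`, and by congruence also
-- `r 0ℤ`, for a suitable nonzero `x`.
simple-zero⇒connected : ∀ {n} (G : Graph n) (r : ℤ → ℤ) → Congruential r → r 0ℤ ≢ 0ℤ →
  (∀ x → charPolyAt G x ≡ x * r x) → Connected G
simple-zero⇒connected G r (congruential cr) r0≢0 factorised s with reachable-or-separated G s
... | inj₁ reaches = reaches
... | inj₂ (c , closed , (p , cp) , (q , cq)) = contradiction
  (ℕ.∣⇒≤ {{ℤ.≢-nonZero r0≢0}} (∣⇒∣ᵤ x∣r0)) (ℕ.<⇒≱ (ℕ.n<1+n ℤ.∣ r 0ℤ ∣))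
  where
  -- Too large to divide the nonzero number `r 0ℤ`.
  x = + suc ℤ.∣ r 0ℤ ∣
  split = charPoly-two-components G c closed cp cq x
  r≡ : r x ≡ proj₁ split * x
  r≡ = ℤ.*-cancelˡ-≡ x _ _ (trans (sym (factorised x)) (trans (proj₂ split) (ℤ.*-comm (proj₁ split * x) x)))
  difference : ∀ a b → b ≡ a + -1ℤ * (a - b)
  difference = solve-∀
  x-0 : x - 0ℤ ≡ x
  x-0 = ℤ.+-identityʳ x
  x∣r0 : x ∣ r 0ℤ
  x∣r0 = subst (x ∣_) (sym (difference (r x) (r 0ℤ)))
    (∣m∣n⇒∣m+n (divides (proj₁ split) r≡) (∣n⇒∣m*n -1ℤ (subst (_∣ (r x - r 0ℤ)) x-0 (cr x 0ℤ))))

isolated-vertex : ∀ {k} (G : Graph (suc k)) → k ≢ 0 → ∀ {a w} → Nonzero a → ∑ a ≡ 0ℤ → Eigenvector G 0ℤ a →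
  Nonzero w → Eigenvector G (+ k) w → ∃[ p ] ∀ v → adj G p v ≡ false
isolated-vertex G k≢0 a≢0 ∑a≡0 a-eigen w≢0 w-eigen =
  separation⇒isolated G (harmonic⇒separation G a≢0 ∑a≡0 a-eigen) k≢0 w≢0 w-eigen

complement-isolated⇒dominating : ∀ {n} (G : Graph n) u → (∀ v → adj (complement G) u v ≡ false) → Dominating G u
complement-isolated⇒dominating G u isolated v u≢v = Bool.not-injective
  (trans (sym (cong (λ b → if b then false else not (adj G u v)) (dec-false (u ≟ v) u≢v))) (isolated v))

dominating-vertex : ∀ {k} (G : Graph (suc k)) → k ≢ 0 → ∀ {a w} → Nonzero a → Eigenvector G (+ suc k) a →
  Nonzero w → Eigenvector G 1ℤ w → ∃[ u ] Dominating G u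
dominating-vertex {k} G k≢0 {a} {w} a≢0 a-eigen w≢0 w-eigen = proj₁ found ,
  complement-isolated⇒dominating G (proj₁ found) (proj₂ found)
  where
  ∑a≡0 : ∑ a ≡ 0ℤ
  ∑a≡0 = eigenvector-sum G a-eigen λ ()
  ∑w≡0 : ∑ w ≡ 0ℤ
  ∑w≡0 = eigenvector-sum G w-eigen λ ()
  found : ∃[ p ] ∀ v → adj (complement G) p v ≡ false
  found = isolated-vertex (complement G) k≢0 a≢0 ∑a≡0
    (subst (λ x → Eigenvector (complement G) x a) (ℤ.+-inverseʳ (+ suc k)) (complement-eigenvector G a-eigen ∑a≡0))
    w≢0 (complement-eigenvector G w-eigen ∑w≡0)

-- Both eigenvalues differ from 0 and from the order of `G`, so the vectors vanish at `u`. Deletion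
-- lowers the eigenvalues to 0 and `k`, as `isolated-vertex` requires, now for the graph itself
-- rather than its complement.
isolated-after-deletion : ∀ {k} (G : Graph (suc (suc k))) {u} → Dominating G u → k ≢ 0 →
  ∀ {w z} → Nonzero w → Eigenvector G 1ℤ w → Nonzero z → Eigenvector G (+ suc k) z →
  ∃[ p ] ∀ v → adj (delete G u) p v ≡ false
isolated-after-deletion {k} G {u} dominating k≢0 {w} {z} w≢0 w-eigen z≢0 z-eigen =
  isolated-vertex (delete G u) k≢0
    (delete-nonzero {w = w} wᵤ≡0 w≢0) (delete-sum {w = w} wᵤ≡0 (eigenvector-sum G w-eigen λ ()))
    (delete-eigenvector G dominating w-eigen wᵤ≡0)
    (delete-nonzero {w = z} zᵤ≡0 z≢0) (delete-eigenvector G dominating z-eigen zᵤ≡0)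
  where
  wᵤ≡0 : w u ≡ 0ℤ
  wᵤ≡0 = dominating-zero G dominating w-eigen (λ ()) (λ ())
  zᵤ≡0 : z u ≡ 0ℤ
  zᵤ≡0 = dominating-zero G dominating z-eigen (λ ()) (λ eq → ℕ.1+n≢n (sym (ℤ.+-injective eq)))

cone-structure : ∀ {k} (G : Graph (suc (suc k))) → k ≢ 0 →
  charPolyAt G (+ suc (suc k)) ≡ 0ℤ → charPolyAt G 1ℤ ≡ 0ℤ → charPolyAt G (+ suc k) ≡ 0ℤ →
  ∃[ H ] G ≅ (K₁ ∨ᴳ (K₁ ∪ᴳ H))
cone-structure {k} G k≢0 root-n root-1 root-n-1 =
  construct (eigenvector G _ root-n) (eigenvector G _ root-1) (eigenvector G _ root-n-1)
  where
  construct : ∃[ a ] Nonzero a × Eigenvector G (+ suc (suc k)) a → ∃[ w ] Nonzero w × Eigenvector G 1ℤ w →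
    ∃[ z ] Nonzero z × Eigenvector G (+ suc k) z → ∃[ H ] G ≅ (K₁ ∨ᴳ (K₁ ∪ᴳ H))
  construct (_ , a≢0 , a-eigen) (_ , w≢0 , w-eigen) (_ , z≢0 , z-eigen) =
    delete (delete G (proj₁ apex)) (proj₁ pendant) , dominating-isolated-≅ G (proj₂ apex) (proj₂ pendant)
    where
    apex : ∃[ u ] Dominating G u
    apex = dominating-vertex G (λ ()) a≢0 a-eigen w≢0 w-eigen
    pendant : ∃[ p ] ∀ v → adj (delete G (proj₁ apex)) p v ≡ false
    pendant = isolated-after-deletion G (proj₂ apex) k≢0 w≢0 w-eigen z≢0 z-eigen

-- Spectra given as lists

opaque
  charProduct : List ℕ → ℤ → ℤ
  charProduct S x = prodℤ (map (λ s → x - + s) S)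

  charProduct-def : ∀ S x → prodℤ (map (λ s → x - + s) S) ≡ charProduct S x
  charProduct-def S x = refl

  charProduct-[] : ∀ x → charProduct [] x ≡ 1ℤ
  charProduct-[] x = refl

  charProduct-∷ : ∀ s S x → charProduct (s ∷ S) x ≡ (x - + s) * charProduct S x
  charProduct-∷ s S x = refl

HasSpectrum : ∀ {n} → Graph n → List ℕ → Set
HasSpectrum G S = ∀ x → charPolyAt G x ≡ charProduct S x

congruential-charProduct : ∀ S → Congruential (charProduct S)
congruential-charProduct []      = congruential-ext (λ x → sym (charProduct-[] x)) (congruential-const 1ℤ)
congruential-charProduct (s ∷ S) = congruential-ext (λ x → sym (charProduct-∷ s S x))
  (congruential-* (λ x → x - + s) (charProduct S)
    (congruential-+ congruential-id (congruential-const (- + s))) (congruential-charProduct S))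

charProduct-↭ : ∀ {S T} → S ↭ T → ∀ x → charProduct S x ≡ charProduct T x
charProduct-↭ Perm.refl x = refl
charProduct-↭ (prep {S} {T} s S↭T) x rewrite charProduct-∷ s S x | charProduct-∷ s T x =
  cong ((x - + s) *_) (charProduct-↭ S↭T x)
charProduct-↭ (Perm.swap {S} {T} s t S↭T) x
  rewrite charProduct-∷ s (t ∷ S) x | charProduct-∷ t S x | charProduct-∷ t (s ∷ T) x | charProduct-∷ s T x
  | charProduct-↭ S↭T x = exchange (x - + s) (x - + t) (charProduct T x)
  where
  exchange : ∀ a b c → a * (b * c) ≡ b * (a * c)
  exchange = solve-∀
charProduct-↭ (Perm.trans S↭T T↭U) x = trans (charProduct-↭ S↭T x) (charProduct-↭ T↭U x)

charProduct-root : ∀ {s S} → s List.∈ S → charProduct S (+ s) ≡ 0ℤ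
charProduct-root {s} {t ∷ S} (here refl) = trans (charProduct-∷ s S (+ s))
  (trans (cong (_* charProduct S (+ s)) (ℤ.+-inverseʳ (+ s))) (ℤ.*-zeroˡ (charProduct S (+ s))))
charProduct-root {s} {t ∷ S} (there s∈S) = trans (charProduct-∷ t S (+ s))
  (trans (cong ((+ s - + t) *_) (charProduct-root s∈S)) (ℤ.*-zeroʳ (+ s - + t)))

charProduct-≢0 : ∀ {S} → All (_≢ 0) S → charProduct S 0ℤ ≢ 0ℤ
charProduct-≢0 {[]} [] eq with trans (sym (charProduct-[] 0ℤ)) eq
... | ()
charProduct-≢0 {s ∷ S} (s≢0 ∷ S≢0) eq with ℤ.i*j≡0⇒i≡0∨j≡0 (0ℤ - + s) (trans (sym (charProduct-∷ s S 0ℤ)) eq)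
... | inj₁ -s≡0 = s≢0 (sym (ℤ.+-injective (ℤ.i-j≡0⇒i≡j 0ℤ (+ s) -s≡0)))
... | inj₂ S≡0  = charProduct-≢0 S≢0 S≡0

charProduct-map-suc : ∀ S x → charProduct (map suc S) x ≡ charProduct S (x - 1ℤ)
charProduct-map-suc []      x = trans (charProduct-[] x) (sym (charProduct-[] (x - 1ℤ)))
charProduct-map-suc (s ∷ S) x = begin
  charProduct (suc s ∷ map suc S) x          ≡⟨ charProduct-∷ (suc s) (map suc S) x ⟩
  (x - + suc s) * charProduct (map suc S) x  ≡⟨ cong₂ _*_ (trans (cong (λ t → x - t) (ℤ.pos-+ 1 s)) (regroup x (+ s)))
                                                 (charProduct-map-suc S x) ⟩
  (x - 1ℤ - + s) * charProduct S (x - 1ℤ)    ≡⟨ charProduct-∷ s S (x - 1ℤ) ⟨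
  charProduct (s ∷ S) (x - 1ℤ)               ∎
  where
  open ≡-Reasoning
  regroup : ∀ x s → x - (1ℤ + s) ≡ x - 1ℤ - s
  regroup = solve-∀

-- Deleting list entries, up to permutation

removeOne-here : ∀ k S → removeOne k (k ∷ S) ≡ S
removeOne-here k S = cong (λ b → if b then S else k ∷ removeOne k S) (dec-true (k ℕ.≟ k) refl)

removeOne-skip : ∀ {k s} S → k ≢ s → removeOne k (s ∷ S) ≡ s ∷ removeOne k S
removeOne-skip {k} {s} S k≢s = cong (λ b → if b then S else s ∷ removeOne k S) (dec-false (k ℕ.≟ s) k≢s)

removeOne-↭ : ∀ k {S T} → S ↭ T → removeOne k S ↭ removeOne k T
removeOne-↭ k Perm.refl = Perm.refl
removeOne-↭ k (prep {S} {T} s S↭T) with k ℕ.≟ s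
... | yes refl rewrite removeOne-here k S | removeOne-here k T = S↭T
... | no k≢s rewrite removeOne-skip S k≢s | removeOne-skip T k≢s = prep s (removeOne-↭ k S↭T)
removeOne-↭ k (Perm.swap {S} {T} s t S↭T) with k ℕ.≟ s | k ℕ.≟ t
... | yes refl | yes refl rewrite removeOne-here k (k ∷ S) | removeOne-here k (k ∷ T) = prep k S↭T
... | yes refl | no k≢t rewrite removeOne-here k (t ∷ S) | removeOne-skip (k ∷ T) k≢t | removeOne-here k T = prep t S↭T
... | no k≢s | yes refl rewrite removeOne-skip (k ∷ S) k≢s | removeOne-here k S | removeOne-here k (s ∷ T) = prep s S↭T
... | no k≢s | no k≢t rewrite removeOne-skip (t ∷ S) k≢s | removeOne-skip S k≢t
  | removeOne-skip (s ∷ T) k≢t | removeOne-skip T k≢s = Perm.swap s t (removeOne-↭ k S↭T)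
removeOne-↭ k (Perm.trans S↭T T↭U) = Perm.trans (removeOne-↭ k S↭T) (removeOne-↭ k T↭U)

removeOne-map-suc : ∀ k S → removeOne (suc k) (map suc S) ≡ map suc (removeOne k S)
removeOne-map-suc k []      = refl
removeOne-map-suc k (s ∷ S) with does (k ℕ.≟ s)
... | true  = refl
... | false = cong (suc s ∷_) (removeOne-map-suc k S)

removeOne-∈ : ∀ {k s S} → s List.∈ S → k ≢ s → s List.∈ removeOne k S
removeOne-∈ {k} {s} {t ∷ S} s∈S k≢s with k ℕ.≟ t
removeOne-∈ {k} {s} {t ∷ S} (here refl) k≢s | yes k≡t = contradiction k≡t k≢s
removeOne-∈ {k} {s} {t ∷ S} (there s∈S) k≢s | yes refl rewrite removeOne-here k S = s∈S
removeOne-∈ {k} {s} {t ∷ S} s∈S k≢s | no k≢t rewrite removeOne-skip S k≢t with s∈S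
... | here refl = here refl
... | there s∈  = there (removeOne-∈ s∈ k≢s)

removeOne-All : ∀ {P : ℕ → Set} k {S} → All P S → All P (removeOne k S)
removeOne-All k [] = []
removeOne-All k {s ∷ S} (p ∷ ps) with does (k ℕ.≟ s)
... | true  = ps
... | false = p ∷ removeOne-All k ps

removeOne-skip-suc : ∀ k {S T a b} → S ↭ a ∷ b ∷ map suc T → suc k ≢ a → suc k ≢ b →
  removeOne (suc k) S ↭ a ∷ b ∷ map suc (removeOne k T)
removeOne-skip-suc k {S} {T} {a} {b} S↭ k≢a k≢b = ↭-trans (removeOne-↭ (suc k) S↭) (↭-reflexive (begin
  removeOne (suc k) (a ∷ b ∷ map suc T) ≡⟨ removeOne-skip (b ∷ map suc T) k≢a ⟩
  a ∷ removeOne (suc k) (b ∷ map suc T) ≡⟨ cong (a ∷_) (removeOne-skip (map suc T) k≢b) ⟩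
  a ∷ b ∷ removeOne (suc k) (map suc T) ≡⟨ cong (λ U → a ∷ b ∷ U) (removeOne-map-suc k T) ⟩
  a ∷ b ∷ map suc (removeOne k T)       ∎))
  where open ≡-Reasoning

-- The entries 1 to n - 1 together with the extra 2 are the successors of 0 to `k` and the extra 1.
-- Both deletions pass over 0 and n, and so act on the shifted part.
spectrum-↭ : ∀ k i j → suc i ≢ suc (suc k) → suc j ≢ suc (suc k) →
  S[ suc i , suc j ] suc (suc k) ^ 2 ↭ 0 ∷ suc (suc k) ∷ map suc (S[ i , j ] k ^ 1)
spectrum-↭ k i j i≢n j≢n =
  removeOne-skip-suc j {T = removeOne i (upTo (suc k) ++ 1 ∷ [])}
    (removeOne-skip-suc i {T = upTo (suc k) ++ 1 ∷ []} whole (λ ()) i≢n) (λ ()) j≢n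
  where
  n = suc (suc k)
  open Perm.PermutationReasoning
  whole : upTo (suc n) ++ 2 ∷ [] ↭ 0 ∷ n ∷ map suc (upTo (suc k) ++ 1 ∷ [])
  whole = prep 0 (begin
    applyUpTo suc n ++ 2 ∷ []                    ≡⟨ cong (_++ 2 ∷ []) (List.map-upTo suc n) ⟨
    map suc (upTo n) ++ 2 ∷ []                   ≡⟨ cong (λ S → map suc S ++ 2 ∷ []) (List.upTo-∷ʳ (suc k)) ⟨
    map suc (upTo (suc k) ∷ʳ suc k) ++ 2 ∷ []    ≡⟨ List.map-++ suc (upTo (suc k) ∷ʳ suc k) (1 ∷ []) ⟨
    map suc ((upTo (suc k) ∷ʳ suc k) ++ 1 ∷ [])  ≡⟨ cong (map suc) (List.++-assoc (upTo (suc k)) (suc k ∷ []) (1 ∷ [])) ⟩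
    map suc (upTo (suc k) ++ suc k ∷ 1 ∷ [])     ↭⟨ Perm.map⁺ suc (Perm.shift (suc k) (upTo (suc k)) (1 ∷ [])) ⟩
    n ∷ map suc (upTo (suc k) ++ 1 ∷ [])         ∎)

-- The factor `x - 1` from the join meets the one contributed by the isolated vertex. It stays on
-- both sides because values at `x = 1` cannot be cancelled pointwise.
charPoly-cone : ∀ {k} (H : Graph k) x → (x - 1ℤ) * charPolyAt (K₁ ∨ᴳ (K₁ ∪ᴳ H)) x ≡
  (x - 1ℤ) * ((x - 0ℤ) * ((x - + suc (suc k)) * charPolyAt H (x - 1ℤ)))
charPoly-cone {k} H x = trans (charPoly-∨ (K₁ ∪ᴳ H) x)
  (trans (cong (x * (x - + suc (suc k)) *_) (charPoly-∪ H (x - 1ℤ)))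
    (regroup x (+ suc (suc k)) (charPolyAt H (x - 1ℤ))))
  where
  regroup : ∀ x n p → x * (x - n) * ((x - 1ℤ) * p) ≡ (x - 1ℤ) * ((x - 0ℤ) * ((x - n) * p))
  regroup = solve-∀

≢⇒-≢0 : ∀ {m n} → m ≢ n → + m - + n ≢ 0ℤ
≢⇒-≢0 m≢n eq = m≢n (ℤ.+-injective (ℤ.i-j≡0⇒i≡j _ _ eq))

*-cancelˡ : ∀ {a} x y → a ≢ 0ℤ → a * x ≡ a * y → x ≡ y
*-cancelˡ {a} x y a≢0 = ℤ.*-cancelˡ-≡ a x y {{ℤ.≢-nonZero a≢0}}

-- Comparing the spectra of the cone and of `H`

module _ (k i j : ℕ) (i<k : suc i < k) (j<k : suc j < k) where

  private
    n : ℕ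
    n = suc (suc k)
    -- The removed numbers are written as successors so that `removeOne` passes over the leading 0
    -- by computation.
    outer inner : List ℕ
    outer = S[ suc (suc i) , suc (suc j) ] n ^ 2
    inner = S[ suc i , suc j ] k ^ 1

  outer-↭ : outer ↭ 0 ∷ n ∷ map suc inner
  outer-↭ = spectrum-↭ k (suc i) (suc j) (ℕ.<⇒≢ (ℕ.m<n⇒m<1+n (ℕ.s≤s i<k))) (ℕ.<⇒≢ (ℕ.m<n⇒m<1+n (ℕ.s≤s j<k)))

  outer-product : ∀ x → charProduct outer x ≡ (x - 0ℤ) * ((x - + n) * charProduct inner (x - 1ℤ))
  outer-product x = begin
    charProduct outer x                       ≡⟨ charProduct-↭ outer-↭ x ⟩
    charProduct (0 ∷ n ∷ map suc inner) x     ≡⟨ charProduct-∷ 0 (n ∷ map suc inner) x ⟩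
    (x - 0ℤ) * charProduct (n ∷ map suc inner) x ≡⟨ cong ((x - 0ℤ) *_) (charProduct-∷ n (map suc inner) x) ⟩
    (x - 0ℤ) * ((x - + n) * charProduct (map suc inner) x)
      ≡⟨ cong (λ p → (x - 0ℤ) * ((x - + n) * p)) (charProduct-map-suc inner x) ⟩
    (x - 0ℤ) * ((x - + n) * charProduct inner (x - 1ℤ)) ∎
    where open ≡-Reasoning

  outer-root : charProduct outer (+ n) ≡ 0ℤ
  outer-root = trans (charProduct-↭ outer-↭ (+ n)) (charProduct-root (there (here refl)))

  inner-root : ∀ {s} → s List.∈ inner → charProduct outer (+ suc s) ≡ 0ℤ
  inner-root {s} s∈ = trans (charProduct-↭ outer-↭ (+ suc s))
    (charProduct-root {suc s} {0 ∷ n ∷ map suc inner} (there (there (List.∈-map⁺ suc s∈))))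

  cone⇒spectrum : ∀ (H : Graph k) → HasSpectrum H inner →
    HasSpectrum (K₁ ∨ᴳ (K₁ ∪ᴳ H)) outer
  cone⇒spectrum H spectrum = eventually-equal (congruential-charPoly K) (congruential-charProduct outer) 1 λ m 1<m →
    *-cancelˡ {+ m - 1ℤ} _ _ (≢⇒-≢0 (ℕ.>⇒≢ 1<m)) (trans (charPoly-cone H (+ m))
      (cong ((+ m - 1ℤ) *_) (trans (cong (λ p → (+ m - 0ℤ) * ((+ m - + n) * p)) (spectrum (+ m - 1ℤ)))
        (sym (outer-product (+ m))))))
    where K = K₁ ∨ᴳ (K₁ ∪ᴳ H)

  spectrum⇒cone : ∀ (H : Graph k) → HasSpectrum (K₁ ∨ᴳ (K₁ ∪ᴳ H)) outer →
    HasSpectrum H inner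
  spectrum⇒cone H spectrum = eventually-equal (congruential-charPoly H) (congruential-charProduct inner) n λ m n<m →
    -- `x - 1ℤ` computes to `+ m`, so the cone identity at `x` speaks of `H` at `m`; for `m` above
    -- `n` the three factors to be cancelled are nonzero.
    let x = + suc m in
    *-cancelˡ {x - + n} _ _ (≢⇒-≢0 (ℕ.>⇒≢ (ℕ.m≤n⇒m≤1+n n<m)))
      (*-cancelˡ {x - 0ℤ} _ _ (≢⇒-≢0 {suc m} {0} λ ())
        (*-cancelˡ {x - 1ℤ} _ _ (≢⇒-≢0 (ℕ.>⇒≢ (ℕ.s≤s (ℕ.≤-trans (ℕ.s≤s ℕ.z≤n) n<m))))
          (trans (sym (charPoly-cone H x)) (cong ((x - 1ℤ) *_) (trans (spectrum x) (outer-product x))))))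

  -- By computation `inner` is 0 followed by positive entries, so 0 is a simple root.
  inner-connected : ∀ (H : Graph k) → HasSpectrum H inner → Connected H
  inner-connected H spectrum = simple-zero⇒connected H (charProduct rest) (congruential-charProduct rest)
    (charProduct-≢0 (removeOne-All (suc j) (removeOne-All (suc i)
      (All.++⁺ (All.applyUpTo⁺₂ suc k (λ _ ())) ((λ ()) ∷ [])))))
    (λ x → trans (spectrum x) (trans (charProduct-∷ 0 rest x) (cong (_* charProduct rest x) (ℤ.+-identityʳ x))))
    where rest = removeOne (suc j) (removeOne (suc i) (applyUpTo suc k ++ 1 ∷ []))

  0∈inner : 0 List.∈ inner
  0∈inner = here refl

  k∈inner : k List.∈ inner
  k∈inner = removeOne-∈ (removeOne-∈ (List.∈-++⁺ˡ (List.∈-upTo⁺ (ℕ.n<1+n k))) (ℕ.<⇒≢ i<k)) (ℕ.<⇒≢ j<k)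

  realizes⇔cone : (G : Graph n) → Connected G →
    Realizes G outer ⇔ Σ (Graph k) λ H → Realizes H inner × (G ≅ (K₁ ∨ᴳ (K₁ ∪ᴳ H)))
  realizes⇔cone G connected = mk⇔ forward backward
    where
    decompose : HasSpectrum G outer → ∃[ H ] G ≅ (K₁ ∨ᴳ (K₁ ∪ᴳ H))
    -- The roots 1 and n - 1 of the outer product are the shifts of the entries 0 and `k` of
    -- `inner`.
    decompose spectrum = cone-structure G (ℕ.>⇒≢ (ℕ.≤-<-trans ℕ.z≤n i<k))
      (trans (spectrum (+ n)) outer-root)
      (trans (spectrum 1ℤ) (inner-root 0∈inner))
      (trans (spectrum (+ suc k)) (inner-root k∈inner))
    transfer : HasSpectrum G outer → ∃[ H ] G ≅ (K₁ ∨ᴳ (K₁ ∪ᴳ H)) →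
      Σ (Graph k) λ H → Realizes H inner × (G ≅ (K₁ ∨ᴳ (K₁ ∪ᴳ H)))
    transfer spectrum (H , iso) = H ,
      (inner-connected H H-spectrum , λ x → trans (H-spectrum x) (sym (charProduct-def inner x))) , iso
      where
      H-spectrum : HasSpectrum H inner
      H-spectrum = spectrum⇒cone H λ x → trans (sym (charPoly-iso G (K₁ ∨ᴳ (K₁ ∪ᴳ H)) iso x)) (spectrum x)
    forward : Realizes G outer → Σ (Graph k) λ H → Realizes H inner × (G ≅ (K₁ ∨ᴳ (K₁ ∪ᴳ H)))
    forward (_ , realized) = transfer spectrum (decompose spectrum)
      where
      spectrum : HasSpectrum G outer
      spectrum x = trans (realized x) (charProduct-def outer x)
    backward : (Σ (Graph k) λ H → Realizes H inner × (G ≅ (K₁ ∨ᴳ (K₁ ∪ᴳ H)))) → Realizes G outer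
    backward (H , (_ , realized) , iso) = connected , λ x → trans (charPoly-iso G (K₁ ∨ᴳ (K₁ ∪ᴳ H)) iso x)
      (trans (cone⇒spectrum H (λ y → trans (realized y) (charProduct-def inner y)) x)
        (sym (charProduct-def outer x)))

theorem4p4 : (n : ℕ) → 6 ≤ n → (i : ℕ) → 1 < i → i < n ∸ 2 → ¬ (i ≡ 2) →
    (G : Graph n) → Connected G →
    Realizes G (S[ i , n ∸ 2 ] n ^ 2) ⇔
    Σ (Graph (n ∸ 2)) (λ H →
    Realizes H (S[ i ∸ 1 , n ∸ 3 ] (n ∸ 2) ^ 1) × (G ≅ (K₁ ∨ᴳ (K₁ ∪ᴳ H))))
theorem4p4 (suc (suc (suc n))) 6≤n (suc zero) (ℕ.s≤s ())
theorem4p4 (suc (suc (suc zero))) (ℕ.s≤s (ℕ.s≤s (ℕ.s≤s ()))) (suc (suc i))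
theorem4p4 (suc (suc (suc (suc m)))) 6≤n (suc (suc i)) 1<i i<k i≢2 G connected =
  -- Here n is m + 4, so `k` is n - 2 and the parameter `j = m` encodes the removed n - 2 as
  -- `suc (suc m)` and the inner n - 3 as `suc m`.
  realizes⇔cone (suc (suc m)) i m (ℕ.<-trans (ℕ.n<1+n (suc i)) i<k) (ℕ.n<1+n (suc m)) G connected
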